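{- The base interpretation of the $\mathcal I^{\mathrm{cp}}$-interpretation (canonical upon the precise interpretation) is a sound type-informative base interpretation of $\mathrm{HA}^\omega$.
   Context: $\mathrm{HA}^\omega$: intuitionistic theory with finite types generated by $\sigma\to\tau$ from ground types $\mathbb N$, $\mathbb B$; constants: combinators $\Pi,\Sigma$, zero $0^{\mathbb N}$, successor $\mathsf S^{\mathbb N\to\mathbb N}$, recursors $\mathsf R_\sigma:\mathbb N\to\sigma\to(\mathbb N\to\sigma\to\sigma)\to\sigma$ (simultaneous recursion allowed), Booleans $0^{\mathbb B},1^{\mathbb B}$, conditionals $\mathrm{Cond}_\sigma:\mathbb B\to\sigma\to\sigma\to\sigma$; relation symbols: only logical equality $\equiv_\sigma$ at every type. Formulas use $\bot,\wedge,\to,\forall x^\sigma,\exists x^\sigma$; $A\vee B$ abbreviates $\exists i^{\mathbb B}((i\equiv0\to A)\wedge(i\equiv1\to B))$. Axioms: equality and combinator axioms ($\Pi xy\equiv x$, $\Sigma xyz\equiv xz(yz)$); $\mathsf S$ injective, $0\notin\mathrm{range}(\mathsf S)$; $\mathsf R0wf\equiv w$, $\mathsf R(\mathsf Sn)wf\equiv fn(\mathsf Rnwf)$; $\neg(0\equiv_{\mathbb B}1)$; $D(0)\wedge D(1)\to\forall i^{\mathbb B}D(i)$ for all formulas $D$; $\mathrm{Cond}(0,x,y)\equiv x$, $\mathrm{Cond}(1,x,y)\equiv y$; induction for all formulas. Target language: the language of $\mathrm{HA}^\omega$ with the extra type constructor $\sigma\mapsto\sigma^*$ (non-empty finite subsets)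 and constants for singleton, union, indexed union $\bigcup_{w\in t}qw$, membership, combinators, conditionals and recursors for all these types, and $\mathrm m:\mathbb N^*\to\mathbb N$ (maximum). $\mathcal S^\omega_*$ is the structure with $\mathcal S_{\mathbb N}=\mathbb N$, $\mathcal S_{\mathbb B}=\{0,1\}$, $\mathcal S_{\rho\to\sigma}$ all functions from $\mathcal S_\rho$ to $\mathcal S_\sigma$, $\mathcal S_{\sigma^*}$ all non-empty finite subsets of $\mathcal S_\sigma$. The target theory $T$ is the set of sentences true in $\mathcal S^\omega_*$. Witnessing types are the types of the target language (ground witnessing types $\mathbb N,\mathbb B$); witnessing terms are terms of such types. $\mathcal L^{\mathcal I}$ adds to the language of $\mathrm{HA}^\omega$ a unary predicate $\mathcal I_\sigma(x^\sigma)$ for each type. Boldface letters are (possibly empty) tuples, $\forall\boldsymbol b\in\boldsymbol B$ is componentwise. A base interpretation assigns to each $\mathcal I_\sigma$ tuples of witnessing types $\boldsymbol\tau_\sigma^+,\boldsymbol\tau_\sigma^-$ and a relation $\langle\mathcal I_\sigma(x)\rangle^{\boldsymbol a}_{\boldsymbol b}$ ($\boldsymbol a:\boldsymbol\tau_\sigma^+$, $\boldsymbol b:\boldsymbol\tau_\sigma^-$); always $\langle x\equiv_\sigma y\rangle$ is $x=y$. $\mathcal U$-interpretation: $\langle\bot\rangle:\equiv\bot$; $\langle A\wedge B\rangle^{\boldsymbol a,\boldsymbol c}_{\boldsymbol b,\boldsymbol d}:\equiv\langle A\rangle^{\boldsymbol a}_{\boldsymbol b}\wedge\langle B\rangle^{\boldsymbol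 c}_{\boldsymbol d}$; $\langle A\to B\rangle^{\boldsymbol f,\boldsymbol g}_{\boldsymbol a,\boldsymbol d}:\equiv\forall\boldsymbol b\in\boldsymbol g\boldsymbol a\boldsymbol d\,\langle A\rangle^{\boldsymbol a}_{\boldsymbol b}\to\langle B\rangle^{\boldsymbol f\boldsymbol a}_{\boldsymbol d}$; $\langle\forall xA\rangle^{\boldsymbol a}_{\boldsymbol b}:\equiv\forall x\langle A\rangle^{\boldsymbol a}_{\boldsymbol b}$; $\langle\exists xA\rangle^{\boldsymbol a}_{\boldsymbol B}:\equiv\exists x\forall\boldsymbol b\in\boldsymbol B\langle A\rangle^{\boldsymbol a}_{\boldsymbol b}$. $A(\boldsymbol x)$ is $\mathcal U$-interpretable if there are closed witnessing terms $\boldsymbol t$ with $T\vdash\forall\boldsymbol b\langle A(\boldsymbol x)\rangle^{\boldsymbol t}_{\boldsymbol b}$. $A^{\mathcal I}$ replaces $\forall x^\sigma(\dots)$ by $\forall x^\sigma(\mathcal I_\sigma(x)\to\dots)$ and $\exists x^\sigma(\dots)$ by $\exists x^\sigma(\mathcal I_\sigma(x)\wedge\dots)$. $A(\boldsymbol x)$ is $\mathcal I$-interpretable if $\forall\boldsymbol x(\mathcal I(\boldsymbol x)\to A^{\mathcal I}(\boldsymbol x))$ is $\mathcal U$-interpretable. The base interpretation is a sound type-informative base interpretation of $\mathrm{HA}^\omega$ if all $\mathcal I_\sigma(c)$ ($c^\sigma$ a constant of $\mathrm{HA}^\omega$) and all $\forall x^\sigma\forall f^{\sigma\to\tau}(\mathcal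 I_\sigma(x)\wedge\mathcal I_{\sigma\to\tau}(f)\to\mathcal I_\tau(fx))$ are $\mathcal U$-interpretable, and all non-logical axioms of $\mathrm{HA}^\omega$ are $\mathcal I$-interpretable. $\mathcal I^{\mathrm{cp}}$ is given by: $\langle\mathcal I_{\mathbb N}(x)\rangle^n$ is $x=n$ ($n:\mathbb N$, no negative witnesses); $\langle\mathcal I_{\mathbb B}(i)\rangle^j$ is $i=j$ ($j:\mathbb B$, no negative witnesses); and canonically at function types, $$\langle\mathcal I_{\rho\to\sigma}(h)\rangle^{\boldsymbol f,\boldsymbol g}_{\boldsymbol a,\boldsymbol d}:\equiv\forall x^\rho(\forall\boldsymbol b\in\boldsymbol g\boldsymbol a\boldsymbol d\,\langle\mathcal I_\rho(x)\rangle^{\boldsymbol a}_{\boldsymbol b}\to\langle\mathcal I_\sigma(hx)\rangle^{\boldsymbol f\boldsymbol a}_{\boldsymbol d}).$$ -}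

module Defs where

open import Data.Bool.Base using (Bool; true; false; if_then_else_)
open import Data.Empty using (⊥)
open import Data.List.Base as List using (List; []; _∷_; _++_; map; foldr; concat)
import Data.List.Extrema.Nat as Extrema
open import Data.List.Membership.Propositional using (_∈_)
open import Data.List.Membership.Propositional.Properties using (∈-map⁺)
import Data.List.Membership.Setoid as SetoidMembership
import Data.List.Properties as List
open import Data.List.NonEmpty.Base as List⁺ using (List⁺; _∷_; toList; _⁺++⁺_)
open import Data.List.Relation.Unary.All as All using (All; []; _∷_)
open import Data.List.Relation.Unary.All.Properties using (++⁺; ++⁻ˡ; ++⁻ʳ)
  renaming (map⁺ to All-map⁺; map⁻ to All-map⁻)
open import Data.List.Relation.Unary.Any as Any using (Any; here; there)
import Data.List.Relation.Unary.Any.Properties as Any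
open import Data.Nat.Base using (ℕ; zero; suc; _≤_)
open import Data.Nat.Properties using (≤-antisym)
open import Data.Product.Base using (Σ-syntax; _×_; _,_; proj₁; proj₂)
open import Data.Sum.Base using (inj₁; inj₂)
open import Function.Base using (_∘_)
open import Function.Bundles using (Func; _⟨$⟩_)
open import Function.Relation.Binary.Setoid.Equality using (_⇨_)
open import Level using (0ℓ)
open import Relation.Binary.Bundles using (Setoid)
open import Relation.Binary.PropositionalEquality as ≡ using (_≡_; refl)
open import Relation.Unary using (U)

infixr 6 _⇒_
infixr 6 _⇒*_

data Ty : Set where
  nat bool : Ty
  _⇒_      : Ty → Ty → Ty
  _*       : Ty → Ty

-- The types of HA^ω, as those types of the target language in which
-- the constructor _* does not occur.
data Plain : Ty → Set where
  nat  : Plain nat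
  bool : Plain bool
  _⇒_  : ∀ {σ τ} → Plain σ → Plain τ → Plain (σ ⇒ τ)

_⇒*_ : List Ty → Ty → Ty
σs ⇒* τ = foldr _⇒_ τ σs

Step : List Ty → Ty → Ty
Step σs τ = nat ⇒ (σs ⇒* τ)

-- The constants of HA^ω, relative to a class P of types.  The family
-- recᶜ is simultaneous recursion: for a tuple of types σs, it gives one
-- constant for each component σ of σs.
data HACon (P : Ty → Set) : Ty → Set where
  Πᶜ    : ∀ {σ τ} → P σ → P τ → HACon P (σ ⇒ τ ⇒ σ)
  Σᶜ    : ∀ {ρ σ τ} → P ρ → P σ → P τ →
          HACon P ((ρ ⇒ σ ⇒ τ) ⇒ (ρ ⇒ σ) ⇒ ρ ⇒ τ)
  zeroᶜ : HACon P nat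
  sucᶜ  : HACon P (nat ⇒ nat)
  recᶜ  : ∀ {σs σ} → All P σs → σ ∈ σs →
          HACon P (nat ⇒ (σs ⇒* (map (Step σs) σs ⇒* σ)))
  0ᴮ 1ᴮ : HACon P bool
  condᶜ : ∀ {σ} → P σ → HACon P (bool ⇒ σ ⇒ σ ⇒ σ)

data TargetCon : Ty → Set where
  ha    : ∀ {σ} → HACon U σ → TargetCon σ
  singᶜ : ∀ {σ} → TargetCon (σ ⇒ σ *)
  ∪ᶜ    : ∀ {σ} → TargetCon (σ * ⇒ σ * ⇒ σ *)
  ⋃ᶜ    : ∀ {σ τ} → TargetCon (σ * ⇒ (σ ⇒ τ *) ⇒ τ *)
  maxᶜ  : TargetCon (nat * ⇒ nat)

embed : ∀ {σ} → HACon Plain σ → HACon U σ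
embed (Πᶜ _ _)    = Πᶜ _ _
embed (Σᶜ _ _ _)  = Σᶜ _ _ _
embed zeroᶜ       = zeroᶜ
embed sucᶜ        = sucᶜ
embed (recᶜ ps i) = recᶜ (All.map _ ps) i
embed 0ᴮ          = 0ᴮ
embed 1ᴮ          = 1ᴮ
embed (condᶜ _)   = condᶜ _

-- Contexts are lists of types; a variable is a de Bruijn index.
Ctx : Set
Ctx = List Ty

infixl 9 _·_

data Tm (C : Ty → Set) (Γ : Ctx) : Ty → Set where
  var : ∀ {σ} → σ ∈ Γ → Tm C Γ σ
  con : ∀ {σ} → C σ → Tm C Γ σ
  _·_ : ∀ {σ τ} → Tm C Γ (σ ⇒ τ) → Tm C Γ σ → Tm C Γ τ

-- Tuples of terms, which also serve as substitutions.
Tms : (Ty → Set) → Ctx → List Ty → Set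
Tms C Γ = All (Tm C Γ)

module _ {C : Ty → Set} where

  infixl 10 _[_] _[_]*

  _[_] : ∀ {Γ Δ σ} → Tm C Γ σ → Tms C Δ Γ → Tm C Δ σ
  var i   [ ρ ] = All.lookup ρ i
  con c   [ ρ ] = con c
  (s · t) [ ρ ] = s [ ρ ] · t [ ρ ]

  _[_]* : ∀ {Γ Δ σs} → Tms C Γ σs → Tms C Δ Γ → Tms C Δ σs
  ts [ ρ ]* = All.map (_[ ρ ]) ts

  vars : ∀ {Γ} → Tms C Γ Γ
  vars = All.tabulate var

  locals : ∀ {Γ} τs → Tms C (τs ++ Γ) τs
  locals τs = ++⁻ˡ τs vars

  wk : ∀ {Γ} τs → Tms C (τs ++ Γ) Γ
  wk τs = ++⁻ʳ τs vars

  lift : ∀ {Γ Δ} τs → Tms C Δ Γ → Tms C (τs ++ Δ) (τs ++ Γ)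
  lift τs ρ = ++⁺ (locals τs) (ρ [ wk τs ]*)

  infixl 9 _·*_ _··_

  _·*_ : ∀ {Γ σs τ} → Tm C Γ (σs ⇒* τ) → Tms C Γ σs → Tm C Γ τ
  t ·* []       = t
  t ·* (s ∷ ss) = (t · s) ·* ss

  _··_ : ∀ {Γ σs τs} → Tms C Γ (map (σs ⇒*_) τs) → Tms C Γ σs → Tms C Γ τs
  ts ·· ss = All.map (_·* ss) (All-map⁻ ts)

toTarget : ∀ {Γ σ} → Tm (HACon Plain) Γ σ → Tm TargetCon Γ σ
toTarget (var i) = var i
toTarget (con c) = con (ha (embed c))
toTarget (s · t) = toTarget s · toTarget t

record Language : Set₁ where
  field
    Type : Ty → Set
    Con  : Ty → Set
    Rel  : List Ty → Set

open Language

-- Equality is present in every language; Rel provides the other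
-- relation symbols.
infix  8 _≈′_
infixr 7 _∧′_
infixr 6 _⇒′_

data Fm (L : Language) (Γ : Ctx) : Set where
  ⊥′        : Fm L Γ
  _∧′_ _⇒′_ : Fm L Γ → Fm L Γ → Fm L Γ
  ∀′ ∃′     : ∀ {σ} → Type L σ → Fm L (σ ∷ Γ) → Fm L Γ
  _≈′_      : ∀ {σ} → Tm (Con L) Γ σ → Tm (Con L) Γ σ → Fm L Γ
  rel       : ∀ {σs} → Rel L σs → Tms (Con L) Γ σs → Fm L Γ

module _ {L : Language} where

  ¬′_ : ∀ {Γ} → Fm L Γ → Fm L Γ
  ¬′ A = A ⇒′ ⊥′

  infixl 10 _⟦_⟧

  _⟦_⟧ : ∀ {Γ Δ} → Fm L Γ → Tms (Con L) Δ Γ → Fm L Δ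
  ⊥′       ⟦ ρ ⟧ = ⊥′
  (A ∧′ B) ⟦ ρ ⟧ = A ⟦ ρ ⟧ ∧′ B ⟦ ρ ⟧
  (A ⇒′ B) ⟦ ρ ⟧ = A ⟦ ρ ⟧ ⇒′ B ⟦ ρ ⟧
  ∀′ p A   ⟦ ρ ⟧ = ∀′ p (A ⟦ lift (_ ∷ []) ρ ⟧)
  ∃′ p A   ⟦ ρ ⟧ = ∃′ p (A ⟦ lift (_ ∷ []) ρ ⟧)
  (s ≈′ t) ⟦ ρ ⟧ = s [ ρ ] ≈′ t [ ρ ]
  rel r ts ⟦ ρ ⟧ = rel r (ts [ ρ ]*)

  close : ∀ {Γ} → All (Type L) Γ → Fm L Γ → Fm L []
  close []       A = A
  close (p ∷ ps) A = close ps (∀′ p A)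

HA : Language
HA = record { Type = Plain ; Con = HACon Plain ; Rel = λ _ → ⊥ }

data 𝓘Rel : List Ty → Set where
  𝓘 : ∀ {σ} → Plain σ → 𝓘Rel (σ ∷ [])

HA𝓘 : Language
HA𝓘 = record { Type = Plain ; Con = HACon Plain ; Rel = 𝓘Rel }

data TargetRel : List Ty → Set where
  mem : ∀ {σ} → TargetRel (σ ∷ σ * ∷ [])

Target : Language
Target = record { Type = U ; Con = TargetCon ; Rel = TargetRel }

pattern x₀ = var (here refl)
pattern x₁ = var (there (here refl))
pattern x₂ = var (there (there (here refl)))

-- Axioms are open formulas, whose context consists of the variables
-- shown and, in the schemata, of a context Γ of parameters.
data Axiom : ∀ {Γ} → Fm HA Γ → Set where
  ≈-refl  : ∀ {σ} → Plain σ → Axiom {σ ∷ []} (x₀ ≈′ x₀)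
  ≈-subst : ∀ {Γ σ} → Plain σ → (A : Fm HA (σ ∷ Γ)) →
            Axiom {σ ∷ σ ∷ Γ}
              (x₁ ≈′ x₀ ⇒′ A ⟦ x₁ ∷ wk (σ ∷ σ ∷ []) ⟧
                        ⇒′ A ⟦ x₀ ∷ wk (σ ∷ σ ∷ []) ⟧)
  Π-eq    : ∀ {σ τ} (p : Plain σ) (q : Plain τ) →
            Axiom {τ ∷ σ ∷ []} (con (Πᶜ p q) · x₁ · x₀ ≈′ x₁)
  Σ-eq    : ∀ {ρ σ τ} (p : Plain ρ) (q : Plain σ) (r : Plain τ) →
            Axiom {ρ ∷ (ρ ⇒ σ) ∷ (ρ ⇒ σ ⇒ τ) ∷ []}
              (con (Σᶜ p q r) · x₂ · x₁ · x₀ ≈′ x₂ · x₀ · (x₁ · x₀))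
  suc-inj : Axiom {nat ∷ nat ∷ []}
              (con sucᶜ · x₁ ≈′ con sucᶜ · x₀ ⇒′ x₁ ≈′ x₀)
  suc≉0   : Axiom {nat ∷ []} (¬′ (con sucᶜ · x₀ ≈′ con zeroᶜ))
  rec-0   : ∀ {σs σ} (ps : All Plain σs) (i : σ ∈ σs) →
            let w = locals σs
                f = wk σs
            in Axiom {σs ++ map (Step σs) σs}
                 (con (recᶜ ps i) · con zeroᶜ ·* w ·* f ≈′ All.lookup w i)
  rec-suc : ∀ {σs σ} (ps : All Plain σs) (i : σ ∈ σs) →
            let n    = x₀
                w    = locals σs [ wk (nat ∷ []) ]*
                f    = wk (nat ∷ σs)
                Rnwf = All.tabulate (λ j → con (recᶜ ps j) · n ·* w ·* f)
            in Axiom {nat ∷ σs ++ map (Step σs) σs}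
                 (con (recᶜ ps i) · (con sucᶜ · n) ·* w ·* f
                   ≈′ All.lookup f (∈-map⁺ (Step σs) i) · n ·* Rnwf)
  0≉1     : Axiom {[]} (¬′ (con 0ᴮ ≈′ con 1ᴮ))
  bool-ind : ∀ {Γ} (D : Fm HA (bool ∷ Γ)) →
            Axiom {Γ} (D ⟦ con 0ᴮ ∷ vars ⟧ ∧′ D ⟦ con 1ᴮ ∷ vars ⟧
                        ⇒′ ∀′ bool D)
  cond-0  : ∀ {σ} (p : Plain σ) →
            Axiom {σ ∷ σ ∷ []} (con (condᶜ p) · con 0ᴮ · x₁ · x₀ ≈′ x₁)
  cond-1  : ∀ {σ} (p : Plain σ) →
            Axiom {σ ∷ σ ∷ []} (con (condᶜ p) · con 1ᴮ · x₁ · x₀ ≈′ x₀)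
  nat-ind : ∀ {Γ} (A : Fm HA (nat ∷ Γ)) →
            Axiom {Γ} (A ⟦ con zeroᶜ ∷ vars ⟧
                        ∧′ ∀′ nat (A ⇒′ A ⟦ con sucᶜ · x₀ ∷ wk (nat ∷ []) ⟧)
                        ⇒′ ∀′ nat A)

-- A non-empty finite subset is presented by a non-empty list of its
-- elements; two lists are equal when they have the same elements.
module FiniteSubsets (S : Setoid 0ℓ 0ℓ) where
  open Setoid S using () renaming (Carrier to A)
  open SetoidMembership S using () renaming (_∈_ to _∈ᴸ_)

  infix 4 _∈ˢ_ _⊆ˢ_

  _∈ˢ_ : A → List⁺ A → Set
  x ∈ˢ xs = x ∈ᴸ toList xs

  _⊆ˢ_ : List⁺ A → List⁺ A → Set
  xs ⊆ˢ ys = ∀ {x} → x ∈ˢ xs → x ∈ˢ ys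

  setoid : Setoid 0ℓ 0ℓ
  setoid = record
    { Carrier = List⁺ A
    ; _≈_ = λ xs ys → xs ⊆ˢ ys × ys ⊆ˢ xs
    ; isEquivalence = record
      { refl  = (λ p → p) , (λ p → p)
      ; sym   = λ (p , q) → q , p
      ; trans = λ (p , q) (p′ , q′) → (λ r → p′ (p r)) , (λ r → q (q′ r))
      }
    }

-- A set is a setoid here, so the functions from one set to another are
-- the maps respecting equality, up to pointwise equality.
⟦_⟧ᵀ : Ty → Setoid 0ℓ 0ℓ
⟦ nat ⟧ᵀ   = ≡.setoid ℕ
⟦ bool ⟧ᵀ  = ≡.setoid Bool
⟦ σ ⇒ τ ⟧ᵀ = ⟦ σ ⟧ᵀ ⇨ ⟦ τ ⟧ᵀ
⟦ σ * ⟧ᵀ   = FiniteSubsets.setoid ⟦ σ ⟧ᵀ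

∣_∣ : Ty → Set
∣ σ ∣ = Setoid.Carrier ⟦ σ ⟧ᵀ

-- Tuples of elements, which also serve as environments.
Env : Ctx → Set
Env = All ∣_∣

Tuple : List Ty → Setoid 0ℓ 0ℓ
Tuple σs = record
  { Carrier = Env σs
  ; _≈_ = λ xs ys → ∀ {σ} (i : σ ∈ σs) →
          Setoid._≈_ ⟦ σ ⟧ᵀ (All.lookup xs i) (All.lookup ys i)
  ; isEquivalence = record
    { refl  = λ {_} {σ} _ → Setoid.refl ⟦ σ ⟧ᵀ
    ; sym   = λ p {σ} i → Setoid.sym ⟦ σ ⟧ᵀ (p i)
    ; trans = λ p q {σ} i → Setoid.trans ⟦ σ ⟧ᵀ (p i) (q i)
    }
  }

private
  module T σ = Setoid ⟦ σ ⟧ᵀ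
  module Ts σs = Setoid (Tuple σs)

∷-cong : ∀ {σ σs} {x y : ∣ σ ∣} {xs ys : Env σs} →
         T._≈_ σ x y → Ts._≈_ σs xs ys → Ts._≈_ (σ ∷ σs) (x ∷ xs) (y ∷ ys)
∷-cong p ps (here refl) = p
∷-cong p ps (there i)   = ps i

curry : ∀ σs τ → Func (Tuple σs) ⟦ τ ⟧ᵀ → ∣ σs ⇒* τ ∣
curry-cong : ∀ σs τ (f g : Func (Tuple σs) ⟦ τ ⟧ᵀ) →
             (∀ xs → T._≈_ τ (f ⟨$⟩ xs) (g ⟨$⟩ xs)) →
             T._≈_ (σs ⇒* τ) (curry σs τ f) (curry σs τ g)

fix-head : ∀ {σ σs} τ → Func (Tuple (σ ∷ σs)) ⟦ τ ⟧ᵀ → ∣ σ ∣ →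
           Func (Tuple σs) ⟦ τ ⟧ᵀ
fix-head {σ} {σs} τ f x = record
  { to   = λ xs → f ⟨$⟩ (x ∷ xs)
  ; cong = λ {xs} {ys} p →
           Func.cong f (∷-cong {σ} {σs} {x} {x} {xs} {ys} (T.refl σ) p)
  }

curry []       τ f = f ⟨$⟩ []
curry (σ ∷ σs) τ f = record
  { to   = λ x → curry σs τ (fix-head τ f x)
  ; cong = λ {x} {y} p →
           curry-cong σs τ (fix-head τ f x) (fix-head τ f y) λ xs →
           Func.cong f (∷-cong {σ} {σs} {x} {y} {xs} {xs} p (Ts.refl σs {xs}))
  }

curry-cong []       τ f g p = p []
curry-cong (σ ∷ σs) τ f g p = λ x →
  curry-cong σs τ (fix-head τ f x) (fix-head τ g x) (λ xs → p (x ∷ xs))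

apply : ∀ σs τ → ∣ σs ⇒* τ ∣ → Env σs → ∣ τ ∣
apply []       τ f []       = f
apply (σ ∷ σs) τ f (x ∷ xs) = apply σs τ (f ⟨$⟩ x) xs

apply-cong : ∀ σs τ {f g} {xs ys} →
             T._≈_ (σs ⇒* τ) f g → Ts._≈_ σs xs ys →
             T._≈_ τ (apply σs τ f xs) (apply σs τ g ys)
apply-cong []       τ {xs = []}     {[]}     p ps = p
apply-cong (σ ∷ σs) τ {f} {g} {x ∷ xs} {y ∷ ys} p ps =
  apply-cong σs τ {xs = xs} {ys}
    (T.trans (σs ⇒* τ) (p x) (Func.cong g (ps (here refl))))
    (λ i → ps (there i))

lookup-tabulate : ∀ {σs} (f : ∀ {σ} → σ ∈ σs → ∣ σ ∣) {σ} (i : σ ∈ σs) →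
                  All.lookup (All.tabulate f) i ≡ f i
lookup-tabulate f (here refl) = refl
lookup-tabulate f (there i)   = lookup-tabulate (f ∘ there) i

module Recursor (σs : List Ty) where

  Steps : List Ty
  Steps = map (Step σs) σs

  rec : ℕ → Env σs → Env Steps → Env σs
  rec zero    w f = w
  rec (suc n) w f = All.tabulate λ {σ} i →
    apply σs σ (All.lookup f (∈-map⁺ (Step σs) i) ⟨$⟩ n) (rec n w f)

  rec-cong : ∀ n {w w′ f f′} → Ts._≈_ σs w w′ → Ts._≈_ Steps f f′ →
             Ts._≈_ σs (rec n w f) (rec n w′ f′)
  rec-cong zero    p q i = p i
  rec-cong (suc n) {w} {w′} {f} {f′} p q {σ} i =
    ≡.subst₂ (T._≈_ σ) (≡.sym (lookup-tabulate _ i)) (≡.sym (lookup-tabulate _ i))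
      (apply-cong σs σ {xs = rec n w f} {rec n w′ f′}
        (q (∈-map⁺ (Step σs) i) n) (rec-cong n {w} {w′} {f} {f′} p q))

  recᴰ : ∀ {σ} → σ ∈ σs → ∣ nat ⇒ (σs ⇒* (Steps ⇒* σ)) ∣
  recᴰ {σ} i = record { to = on-nat ; cong = λ { refl → T.refl (σs ⇒* (Steps ⇒* σ)) } }
    where
    on-step : ℕ → Env σs → Func (Tuple Steps) ⟦ σ ⟧ᵀ
    on-step n w = record
      { to   = λ f → All.lookup (rec n w f) i
      ; cong = λ {f} {f′} q → rec-cong n {w} {w} {f} {f′} (Ts.refl σs {w}) q i
      }
    on-init : ℕ → Func (Tuple σs) ⟦ Steps ⇒* σ ⟧ᵀ
    on-init n = record
      { to   = λ w → curry Steps σ (on-step n w)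
      ; cong = λ {w} {w′} p → curry-cong Steps σ (on-step n w) (on-step n w′) λ f →
               rec-cong n {w} {w′} {f} {f} p (Ts.refl Steps {f}) i
      }
    on-nat : ℕ → ∣ σs ⇒* (Steps ⇒* σ) ∣
    on-nat n = curry σs (Steps ⇒* σ) (on-init n)

module SetOperations where

  toList-concatMap : ∀ {A B : Set} (f : A → List⁺ B) xs →
    toList (List⁺.concatMap f xs) ≡ List.concatMap (toList ∘ f) (toList xs)
  toList-concatMap f (x ∷ xs) = ≡.cong (λ ys → toList (f x) ++ concat ys)
                                  (≡.sym (List.map-∘ xs))

  sing : ∀ σ → ∣ σ ⇒ σ * ∣
  sing σ = record
    { to   = λ x → x ∷ []
    ; cong = λ p → (λ { (here q) → here (T.trans σ q p) })
                 , (λ { (here q) → here (T.trans σ q (T.sym σ p)) })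
    }

  ∪-mono : ∀ σ (xs ys {xs′ ys′} : ∣ σ * ∣) → let open FiniteSubsets ⟦ σ ⟧ᵀ in
           xs ⊆ˢ xs′ → ys ⊆ˢ ys′ → (xs ⁺++⁺ ys) ⊆ˢ (xs′ ⁺++⁺ ys′)
  ∪-mono σ xs ys {xs′} p q r with Any.++⁻ (toList xs) r
  ... | inj₁ i = Any.++⁺ˡ (p i)
  ... | inj₂ j = Any.++⁺ʳ (toList xs′) (q j)

  ∪ : ∀ σ → ∣ σ * ⇒ σ * ⇒ σ * ∣
  ∪ σ = record
    { to = λ xs → record
      { to   = λ ys → xs ⁺++⁺ ys
      ; cong = λ {ys} {ys′} (p , q) → ∪-mono σ xs ys {xs} {ys′} (λ r → r) p
                                    , ∪-mono σ xs ys′ {xs} {ys} (λ r → r) q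
      }
    ; cong = λ {xs} {xs′} (p , q) ys → ∪-mono σ xs ys {xs′} {ys} p (λ r → r)
                                     , ∪-mono σ xs′ ys {xs} {ys} q (λ r → r)
    }

  ⋃-mono : ∀ σ τ (xs xs′ : ∣ σ * ∣) (f g : ∣ σ ⇒ τ * ∣) →
           FiniteSubsets._⊆ˢ_ ⟦ σ ⟧ᵀ xs xs′ →
           (∀ x → FiniteSubsets._⊆ˢ_ ⟦ τ ⟧ᵀ (f ⟨$⟩ x) (g ⟨$⟩ x)) →
           FiniteSubsets._⊆ˢ_ ⟦ τ ⟧ᵀ (List⁺.concatMap (f ⟨$⟩_) xs)
                                     (List⁺.concatMap (g ⟨$⟩_) xs′)
  ⋃-mono σ τ xs xs′ f g p q {y} r =
    ≡.subst (y ∈ᵀ_) (≡.sym (toList-concatMap (g ⟨$⟩_) xs′))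
      (Any.concatMap⁺ (toList ∘ (g ⟨$⟩_))
        (transfer (Any.concatMap⁻ (toList ∘ (f ⟨$⟩_))
          (≡.subst (y ∈ᵀ_) (toList-concatMap (f ⟨$⟩_) xs) r))))
    where
    open SetoidMembership ⟦ τ ⟧ᵀ using () renaming (_∈_ to _∈ᵀ_)
    open SetoidMembership ⟦ σ ⟧ᵀ using (find)
    transfer : Any (λ x → y ∈ᵀ toList (f ⟨$⟩ x)) (toList xs) →
               Any (λ x → y ∈ᵀ toList (g ⟨$⟩ x)) (toList xs′)
    transfer i with find i
    ... | x , x∈xs , y∈fx =
      Any.map (λ x≈z → proj₁ (Func.cong g x≈z) (q x y∈fx)) (p x∈xs)

  ⋃ : ∀ σ τ → ∣ σ * ⇒ (σ ⇒ τ *) ⇒ τ * ∣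
  ⋃ σ τ = record
    { to = λ xs → record
      { to   = λ f → List⁺.concatMap (f ⟨$⟩_) xs
      ; cong = λ {f} {g} e →
          ⋃-mono σ τ xs xs f g (λ r → r) (λ x → proj₁ (e x))
        , ⋃-mono σ τ xs xs g f (λ r → r) (λ x → proj₂ (e x))
      }
    ; cong = λ {xs} {xs′} (p , q) f →
          ⋃-mono σ τ xs xs′ f f p (λ _ r → r)
        , ⋃-mono σ τ xs′ xs f f q (λ _ r → r)
    }

  max : List⁺ ℕ → ℕ
  max (x ∷ xs) = Extrema.max x xs

  max-mono : ∀ xs ys → FiniteSubsets._⊆ˢ_ (≡.setoid ℕ) xs ys → max xs ≤ max ys
  max-mono (x ∷ xs) (y ∷ ys) p =
    Extrema.max≤v⁺ (bound (p (here refl)))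
      (All.tabulate (λ i → bound (p (there i))))
    where
    bound : ∀ {z} → z ∈ (y ∷ ys) → z ≤ Extrema.max y ys
    bound (here refl) = Extrema.⊥≤max y ys
    bound (there i)   = All.lookup (Extrema.xs≤max y ys) i

  maxᴰ : ∣ nat * ⇒ nat ∣
  maxᴰ = record
    { to   = max
    ; cong = λ {xs} {ys} (p , q) → ≤-antisym (max-mono xs ys p) (max-mono ys xs q)
    }

⟦_⟧ᴴ : ∀ {σ} → HACon U σ → ∣ σ ∣
⟦ Πᶜ {σ} {τ} _ _ ⟧ᴴ = record
  { to   = λ x → record { to = λ _ → x ; cong = λ _ → T.refl σ }
  ; cong = λ p _ → p
  }
⟦ Σᶜ {ρ} {σ} {τ} _ _ _ ⟧ᴴ = record
  { to = λ x → record
    { to = λ y → record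
      { to   = λ z → x ⟨$⟩ z ⟨$⟩ (y ⟨$⟩ z)
      ; cong = λ {z} {z′} p →
          T.trans τ (Func.cong x p (y ⟨$⟩ z))
                    (Func.cong (x ⟨$⟩ z′) (Func.cong y p))
      }
    ; cong = λ p z → Func.cong (x ⟨$⟩ z) (p z)
    }
  ; cong = λ p y z → p z (y ⟨$⟩ z)
  }
⟦ zeroᶜ ⟧ᴴ    = zero
⟦ sucᶜ ⟧ᴴ     = record { to = suc ; cong = ≡.cong suc }
⟦ recᶜ _ i ⟧ᴴ = Recursor.recᴰ _ i
⟦ 0ᴮ ⟧ᴴ       = false
⟦ 1ᴮ ⟧ᴴ       = true
⟦ condᶜ {σ} _ ⟧ᴴ = record
  { to = λ b → record
    { to = λ x → record
      { to   = λ y → if b then y else x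
      ; cong = λ p → if-cong b (T.refl σ) p
      }
    ; cong = λ p y → if-cong b p (T.refl σ)
    }
  ; cong = λ { refl x y → T.refl σ }
  }
  where
  if-cong : ∀ b {x x′ y y′ : ∣ σ ∣} → T._≈_ σ x x′ → T._≈_ σ y y′ →
            T._≈_ σ (if b then y else x) (if b then y′ else x′)
  if-cong false p q = p
  if-cong true  p q = q

⟦_⟧ᶜ : ∀ {σ} → TargetCon σ → ∣ σ ∣
⟦ ha c ⟧ᶜ        = ⟦ c ⟧ᴴ
⟦ singᶜ {σ} ⟧ᶜ   = SetOperations.sing σ
⟦ ∪ᶜ {σ} ⟧ᶜ      = SetOperations.∪ σ
⟦ ⋃ᶜ {σ} {τ} ⟧ᶜ  = SetOperations.⋃ σ τ
⟦ maxᶜ ⟧ᶜ        = SetOperations.maxᴰ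

eval : ∀ {Γ σ} → Tm TargetCon Γ σ → Env Γ → ∣ σ ∣
eval (var i) η = All.lookup η i
eval (con c) η = ⟦ c ⟧ᶜ
eval (s · t) η = eval s η ⟨$⟩ eval t η

Holds : ∀ {Γ} → Fm Target Γ → Env Γ → Set
Holds ⊥′           η = ⊥
Holds (A ∧′ B)     η = Holds A η × Holds B η
Holds (A ⇒′ B)     η = Holds A η → Holds B η
Holds (∀′ {σ} _ A) η = (x : ∣ σ ∣) → Holds A (x ∷ η)
Holds (∃′ {σ} _ A) η = Σ[ x ∈ ∣ σ ∣ ] Holds A (x ∷ η)
Holds (_≈′_ {σ} s t) η = Setoid._≈_ ⟦ σ ⟧ᵀ (eval s η) (eval t η)
Holds (rel (mem {σ}) (s ∷ t ∷ [])) η =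
  FiniteSubsets._∈ˢ_ ⟦ σ ⟧ᵀ (eval s η) (eval t η)

-- T is the set of sentences true in S^ω_*.  It is closed under deduction,
-- so that provability of an open formula from T is the truth of its
-- universal closure.
T⊢_ : ∀ {Γ} → Fm Target Γ → Set
T⊢ A = ∀ η → Holds A η

WTms : Ctx → List Ty → Set
WTms = Tms TargetCon

∀* : ∀ {Γ} τs → Fm Target (τs ++ Γ) → Fm Target Γ
∀* []       A = A
∀* (τ ∷ τs) A = ∀* τs (∀′ _ A)

∀∈ : ∀ {Γ} τs → WTms Γ (map _* τs) → Fm Target (τs ++ Γ) → Fm Target Γ
∀∈ []       []       A = A
∀∈ (τ ∷ τs) (B ∷ Bs) A =
  ∀∈ τs Bs (∀′ _ (rel mem (x₀ ∷ B [ wk (τ ∷ τs) ] ∷ []) ⇒′ A))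

-- The types of the witnesses 𝐟, 𝐠 of an implication whose premise has
-- witnesses of types σs⁺, σs⁻ and whose conclusion has positive
-- witnesses of types τs⁺ and negative ones of types τs⁻.
module Arrow (σs⁺ σs⁻ τs⁺ τs⁻ : List Ty) where

  𝐟-types 𝐠-types : List Ty
  𝐟-types = map (σs⁺ ⇒*_) τs⁺
  𝐠-types = map ((σs⁺ ++ τs⁻) ⇒*_) (map _* σs⁻)

  pos neg : List Ty
  pos = 𝐟-types ++ 𝐠-types
  neg = σs⁺ ++ τs⁻

  module Parts {Γ} (fg : WTms Γ pos) (ad : WTms Γ neg) where
    𝐟𝐚 : WTms Γ τs⁺
    𝐟𝐚 = ++⁻ˡ 𝐟-types fg ·· ++⁻ˡ σs⁺ ad

    𝐠𝐚𝐝 : WTms Γ (map _* σs⁻)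
    𝐠𝐚𝐝 = ++⁻ʳ 𝐟-types fg ·· ad

    𝐚 : WTms Γ σs⁺
    𝐚 = ++⁻ˡ σs⁺ ad

    𝐝 : WTms Γ τs⁻
    𝐝 = ++⁻ʳ σs⁺ ad

record BaseInterpretation : Set where
  field
    pos neg  : ∀ {σ} → Plain σ → List Ty
    relation : ∀ {σ} (p : Plain σ) → Fm Target (σ ∷ pos p ++ neg p)

  ⟨𝓘⟩ : ∀ {Γ σ} (p : Plain σ) →
        Tm TargetCon Γ σ → WTms Γ (pos p) → WTms Γ (neg p) → Fm Target Γ
  ⟨𝓘⟩ p x a b = relation p ⟦ x ∷ ++⁺ a b ⟧

module UInterpretation (I : BaseInterpretation) where
  private module I = BaseInterpretation I

  infix 10 _⁺ _⁻

  _⁺ _⁻ : ∀ {Γ} → Fm HA𝓘 Γ → List Ty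
  ⊥′ ⁺             = []
  (A ∧′ B) ⁺       = A ⁺ ++ B ⁺
  (A ⇒′ B) ⁺       = Arrow.pos (A ⁺) (A ⁻) (B ⁺) (B ⁻)
  ∀′ _ A ⁺         = A ⁺
  ∃′ _ A ⁺         = A ⁺
  (_ ≈′ _) ⁺       = []
  rel (𝓘 p) _ ⁺    = I.pos p

  ⊥′ ⁻             = []
  (A ∧′ B) ⁻       = A ⁻ ++ B ⁻
  (A ⇒′ B) ⁻       = Arrow.neg (A ⁺) (A ⁻) (B ⁺) (B ⁻)
  ∀′ _ A ⁻         = A ⁻
  ∃′ _ A ⁻         = map _* (A ⁻)
  (_ ≈′ _) ⁻       = []
  rel (𝓘 p) _ ⁻    = I.neg p

  -- ⟨ A ⟩ x a b is the interpretation of A, with terms x for the free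
  -- variables of A and terms a, b for the witnesses.
  ⟨_⟩ : ∀ {Γ Δ} (A : Fm HA𝓘 Γ) →
        WTms Δ Γ → WTms Δ (A ⁺) → WTms Δ (A ⁻) → Fm Target Δ
  ⟨ ⊥′ ⟩ x _ _ = ⊥′
  ⟨ A ∧′ B ⟩ x ac bd =
    ⟨ A ⟩ x (++⁻ˡ (A ⁺) ac) (++⁻ˡ (A ⁻) bd) ∧′
    ⟨ B ⟩ x (++⁻ʳ (A ⁺) ac) (++⁻ʳ (A ⁻) bd)
  ⟨ A ⇒′ B ⟩ x fg ad =
    ∀∈ (A ⁻) 𝐠𝐚𝐝 (⟨ A ⟩ (x [ wk (A ⁻) ]*) (𝐚 [ wk (A ⁻) ]*) (locals (A ⁻)))
      ⇒′ ⟨ B ⟩ x 𝐟𝐚 𝐝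
    where open Arrow.Parts (A ⁺) (A ⁻) (B ⁺) (B ⁻) fg ad
  ⟨ ∀′ {σ} _ A ⟩ x a b =
    ∀′ _ (⟨ A ⟩ (lift (σ ∷ []) x) (a [ wk (σ ∷ []) ]*) (b [ wk (σ ∷ []) ]*))
  ⟨ ∃′ {σ} _ A ⟩ x a B =
    ∃′ _ (∀∈ (A ⁻) (B [ wk (σ ∷ []) ]*)
      (⟨ A ⟩ (lift (σ ∷ []) x [ wk (A ⁻) ]*)
             (a [ wk (σ ∷ []) ]* [ wk (A ⁻) ]*)
             (locals (A ⁻))))
  ⟨ s ≈′ t ⟩ x _ _ = toTarget s [ x ] ≈′ toTarget t [ x ]
  ⟨ rel (𝓘 p) (t ∷ []) ⟩ x a b = I.⟨𝓘⟩ p (toTarget t [ x ]) a b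

  UInterpretable : ∀ {Γ} → Fm HA𝓘 Γ → Set
  UInterpretable {Γ} A =
    Σ[ t ∈ WTms [] (A ⁺) ]
      T⊢ ∀* {Γ} (A ⁻) (⟨ A ⟩ (wk (A ⁻)) (t [ [] ]*) (locals (A ⁻)))

infix 10 _^𝓘

_^𝓘 : ∀ {Γ} → Fm HA Γ → Fm HA𝓘 Γ
⊥′ ^𝓘       = ⊥′
(A ∧′ B) ^𝓘 = A ^𝓘 ∧′ B ^𝓘
(A ⇒′ B) ^𝓘 = A ^𝓘 ⇒′ B ^𝓘
∀′ p A ^𝓘   = ∀′ p (rel (𝓘 p) (x₀ ∷ []) ⇒′ A ^𝓘)
∃′ p A ^𝓘   = ∃′ p (rel (𝓘 p) (x₀ ∷ []) ∧′ A ^𝓘)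
(s ≈′ t) ^𝓘 = s ≈′ t

-- 𝓘(𝐭) → A for a tuple 𝐭, in the curried form 𝓘(t₁) → … → 𝓘(tₙ) → A.
-- Up to order, its witnesses are those of the form with a conjunction as premise,
-- and it needs no empty conjunction when the tuple is empty.
𝓘[_]_⇒_ : ∀ {Γ σs} → All Plain σs → Tms (HACon Plain) Γ σs →
          Fm HA𝓘 Γ → Fm HA𝓘 Γ
𝓘[ [] ]     []       ⇒ A = A
𝓘[ p ∷ ps ] (t ∷ ts) ⇒ A = rel (𝓘 p) (t ∷ []) ⇒′ 𝓘[ ps ] ts ⇒ A

record SoundTypeInformative (I : BaseInterpretation) : Set where
  open UInterpretation I

  𝓘Interpretable : ∀ {Γ} → All Plain Γ → Fm HA Γ → Set
  𝓘Interpretable ps A = UInterpretable (close ps (𝓘[ ps ] vars ⇒ (A ^𝓘)))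

  field
    constants   : ∀ {σ} (p : Plain σ) (c : HACon Plain σ) →
                  UInterpretable {[]} (rel (𝓘 p) (con c ∷ []))
    application : ∀ {σ τ} (p : Plain σ) (q : Plain τ) →
                  UInterpretable {[]} (∀′ p (∀′ (p ⇒ q)
                    (rel (𝓘 p) (x₁ ∷ []) ∧′ rel (𝓘 (p ⇒ q)) (x₀ ∷ [])
                      ⇒′ rel (𝓘 q) (x₀ · x₁ ∷ []))))
    axioms      : ∀ {Γ} (ps : All Plain Γ) {A : Fm HA Γ} → Axiom A →
                  𝓘Interpretable ps A

module CP where

  pos neg : ∀ {σ} → Plain σ → List Ty
  pos nat     = nat ∷ []
  pos bool    = bool ∷ []
  pos (p ⇒ q) = Arrow.pos (pos p) (neg p) (pos q) (neg q)
  neg nat     = []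
  neg bool    = []
  neg (p ⇒ q) = Arrow.neg (pos p) (neg p) (pos q) (neg q)

  relation : ∀ {σ} (p : Plain σ) → Fm Target (σ ∷ pos p ++ neg p)
  relation nat  = x₀ ≈′ x₁
  relation bool = x₀ ≈′ x₁
  relation {σ ⇒ τ} (p ⇒ q) =
    ∀′ {σ = σ} _
      (∀∈ (neg p) 𝐠𝐚𝐝
         (relation p ⟦ x₀ [ w ] ∷ ++⁺ (𝐚 [ w ]*) (locals (neg p)) ⟧)
       ⇒′ relation q ⟦ h · x₀ ∷ ++⁺ 𝐟𝐚 𝐝 ⟧)
    where
    w : WTms (neg p ++ (σ ∷ (σ ⇒ τ) ∷ pos (p ⇒ q) ++ neg (p ⇒ q)))
             (σ ∷ (σ ⇒ τ) ∷ pos (p ⇒ q) ++ neg (p ⇒ q))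
    w = wk (neg p)
    h : Tm TargetCon (σ ∷ (σ ⇒ τ) ∷ pos (p ⇒ q) ++ neg (p ⇒ q)) (σ ⇒ τ)
    h = x₁
    fgad : WTms (σ ∷ (σ ⇒ τ) ∷ pos (p ⇒ q) ++ neg (p ⇒ q))
                (pos (p ⇒ q) ++ neg (p ⇒ q))
    fgad = wk (σ ∷ (σ ⇒ τ) ∷ [])
    open Arrow.Parts (pos p) (neg p) (pos q) (neg q)
           (++⁻ˡ (pos (p ⇒ q)) fgad) (++⁻ʳ (pos (p ⇒ q)) fgad)

𝓘ᶜᵖ : BaseInterpretation
𝓘ᶜᵖ = record { CP }

{-# OPTIONS --safe #-}
module Submission where

-- In the model, a formula with witnesses of types 𝛕⁺, 𝛕⁻ is a relation between
-- tuples 𝐚 : 𝛕⁺ and 𝐛 : 𝛕⁻, possibly depending on parameters.  Such relations,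
-- with closed terms as realizers of entailments, satisfy the rules of
-- intuitionistic logic: composition takes indexed unions of the sets of
-- negative witnesses, and pairing takes binary unions.  They also satisfy
-- induction over 𝓘_ℕ and case distinction over 𝓘_𝔹, because these predicates
-- are interpreted by equality, so that a witness reveals the number or Boolean.
-- As 𝓘_{ρ→σ}(h) is the interpretation of ∀x (𝓘_ρ(x) → 𝓘_σ(hx)), all constants
-- satisfy 𝓘 by reasoning in this logic, the recursors by induction.  The
-- axioms relativized to 𝓘 are true equations or follow from these rules.

open import Defs
open import Data.Bool.Base using (Bool; true; false; if_then_else_)
open import Data.Empty using (⊥)
open import Data.List.Base using (List; []; _∷_; _++_; map)
open import Data.List.Membership.Propositional using (_∈_)
open import Data.List.Membership.Propositional.Properties using (∈-map⁺)
import Data.List.Membership.Setoid as SetoidMembership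
open import Data.List.NonEmpty.Base using (_∷_; toList)
open import Data.List.Relation.Unary.All as All using (All; []; _∷_)
open import Data.List.Relation.Unary.All.Properties using (++⁺; ++⁻ˡ; ++⁻ʳ; map-cong; map-∘; lookup-map)
  renaming (map⁺ to All-map⁺; map⁻ to All-map⁻)
open import Data.List.Relation.Unary.Any as Any using (here; there)
import Data.List.Relation.Unary.Any.Properties as Any
open import Data.Nat.Base using (ℕ; zero; suc)
open import Data.Product.Base using (Σ-syntax; _×_; _,_; proj₁; proj₂; uncurry)
open import Data.Unit.Base using (⊤; tt)
open import Function.Base using (_∘_; id)
open import Function.Bundles using (Func; _⟨$⟩_; _⇔_; mk⇔; module Equivalence)
open import Function.Construct.Composition using (_⇔-∘_)
open import Function.Construct.Identity using (⇔-id)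
open import Relation.Binary.Bundles using (Setoid)
open import Relation.Binary.PropositionalEquality
  using (_≡_; refl; sym; trans; cong; cong₂; subst; subst₂; module ≡-Reasoning)

-- The functions of the model are setoid maps, so two of them with the same values need not be
-- related by `_≡_`, while the relation of a problem is an arbitrary family of Agda types that need
-- not respect the setoid equality. For this reason problems do not compute with terms. A realizer
-- is an Agda function on environments, accompanied by terms that define it. Equations between such
-- functions are pointwise, and functions obtained by abstraction are evaluated only at full tuples
-- of arguments, where bracket abstraction does yield `_≡_`. The free variables of a formula become
-- the parameter space of a problem, which turns substitution into reindexing. Realizers never see
-- the parameters: whatever they know about a free variable reaches them through a witness of its 𝓘.

private
  variable
    Γ Δ Θ : Ctx
    σ τ : Ty
    σs τs : List Ty

-- Tuples and the evaluation of terms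

module _ {P : Ty → Set} where

  ++⁻ˡ-++⁺ : (xs : All P σs) (ys : All P τs) → ++⁻ˡ σs (++⁺ xs ys) ≡ xs
  ++⁻ˡ-++⁺ []       ys = refl
  ++⁻ˡ-++⁺ (x ∷ xs) ys = cong (x ∷_) (++⁻ˡ-++⁺ xs ys)

  ++⁻ʳ-++⁺ : (xs : All P σs) (ys : All P τs) → ++⁻ʳ σs (++⁺ xs ys) ≡ ys
  ++⁻ʳ-++⁺ []       ys = refl
  ++⁻ʳ-++⁺ (x ∷ xs) ys = ++⁻ʳ-++⁺ xs ys

  ++⁺-++⁻ : ∀ σs {τs} (xs : All P (σs ++ τs)) → ++⁺ (++⁻ˡ σs xs) (++⁻ʳ σs xs) ≡ xs
  ++⁺-++⁻ []       xs       = refl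
  ++⁺-++⁻ (σ ∷ σs) (x ∷ xs) = cong (x ∷_) (++⁺-++⁻ σs xs)

  tabulate-lookup : (xs : All P σs) → All.tabulate (All.lookup xs) ≡ xs
  tabulate-lookup []       = refl
  tabulate-lookup (x ∷ xs) = cong (x ∷_) (tabulate-lookup xs)

  tabulate-cong : {f g : ∀ {σ} → σ ∈ σs → P σ} →
                  (∀ {σ} (i : σ ∈ σs) → f i ≡ g i) → All.tabulate f ≡ All.tabulate g
  tabulate-cong {σs = []}    p = refl
  tabulate-cong {σs = _ ∷ _} p = cong₂ _∷_ (p (here refl)) (tabulate-cong (p ∘ there))

  -- The tuple of types map _* (σs ++ τs) is only propositionally equal to
  -- map _* σs ++ map _* τs, whence these variants of ++⁺, ++⁻ˡ and ++⁻ʳ.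
  join : All P (map _* σs) → All P (map _* τs) → All P (map _* (σs ++ τs))
  join {σs = []}    []       ys = ys
  join {σs = _ ∷ _} (x ∷ xs) ys = x ∷ join xs ys

  splitˡ : ∀ σs {τs} → All P (map _* (σs ++ τs)) → All P (map _* σs)
  splitˡ []       xs       = []
  splitˡ (_ ∷ σs) (x ∷ xs) = x ∷ splitˡ σs xs

  splitʳ : ∀ σs {τs} → All P (map _* (σs ++ τs)) → All P (map _* τs)
  splitʳ []       xs       = xs
  splitʳ (_ ∷ σs) (x ∷ xs) = splitʳ σs xs

module _ {P Q : Ty → Set} (f : ∀ {σ} → P σ → Q σ) where

  map-++⁺ : (xs : All P σs) (ys : All P τs) →
            All.map f (++⁺ xs ys) ≡ ++⁺ (All.map f xs) (All.map f ys)
  map-++⁺ []       ys = refl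
  map-++⁺ (x ∷ xs) ys = cong (_ ∷_) (map-++⁺ xs ys)

  map-++⁻ˡ : ∀ σs {τs} (xs : All P (σs ++ τs)) →
             All.map f (++⁻ˡ σs xs) ≡ ++⁻ˡ σs (All.map f xs)
  map-++⁻ˡ []       xs       = refl
  map-++⁻ˡ (_ ∷ σs) (x ∷ xs) = cong (_ ∷_) (map-++⁻ˡ σs xs)

  map-++⁻ʳ : ∀ σs {τs} (xs : All P (σs ++ τs)) →
             All.map f (++⁻ʳ σs xs) ≡ ++⁻ʳ σs (All.map f xs)
  map-++⁻ʳ []       xs       = refl
  map-++⁻ʳ (_ ∷ σs) (x ∷ xs) = map-++⁻ʳ σs xs

  map-tabulate : (g : ∀ {σ} → σ ∈ σs → P σ) →
                 All.map f (All.tabulate g) ≡ All.tabulate (f ∘ g)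
  map-tabulate {σs = []}    g = refl
  map-tabulate {σs = _ ∷ _} g = cong (_ ∷_) (map-tabulate (g ∘ there))

  map-join : (xs : All P (map _* σs)) (ys : All P (map _* τs)) →
             All.map f (join {σs = σs} xs ys) ≡ join {σs = σs} (All.map f xs) (All.map f ys)
  map-join {σs = []}    []       ys = refl
  map-join {σs = _ ∷ _} (x ∷ xs) ys = cong (_ ∷_) (map-join xs ys)

  map-splitˡ : ∀ σs {τs} (xs : All P (map _* (σs ++ τs))) →
               All.map f (splitˡ σs xs) ≡ splitˡ σs (All.map f xs)
  map-splitˡ []       xs       = refl
  map-splitˡ (_ ∷ σs) (x ∷ xs) = cong (_ ∷_) (map-splitˡ σs xs)

  map-splitʳ : ∀ σs {τs} (xs : All P (map _* (σs ++ τs))) →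
               All.map f (splitʳ σs xs) ≡ splitʳ σs (All.map f xs)
  map-splitʳ []       xs       = refl
  map-splitʳ (_ ∷ σs) (x ∷ xs) = map-splitʳ σs xs

-- The substitution lemmas are wanted twice: for witnessing terms and, through `toTarget`, for terms
-- of HA^ω. All they rest on are the clauses of evaluation for variables, constants and application.
module Evaluation
  {C : Ty → Set} (⟦_⟧ : ∀ {σ} → C σ → ∣ σ ∣)
  (eval : ∀ {Γ σ} → Tm C Γ σ → Env Γ → ∣ σ ∣)
  (eval-var : ∀ {Γ σ} (i : σ ∈ Γ) η → eval (var i) η ≡ All.lookup η i)
  (eval-con : ∀ {Γ σ} (c : C σ) (η : Env Γ) → eval (con c) η ≡ ⟦ c ⟧)
  (eval-app : ∀ {Γ σ τ} (s : Tm C Γ (σ ⇒ τ)) (t : Tm C Γ σ) η → eval (s · t) η ≡ eval s η ⟨$⟩ eval t η)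
  where

  eval* : Tms C Γ σs → Env Γ → Env σs
  eval* ts η = All.map (λ t → eval t η) ts

  eval-[] : (t : Tm C Γ σ) (ρ : Tms C Δ Γ) (η : Env Δ) →
            eval (t [ ρ ]) η ≡ eval t (eval* ρ η)
  eval-[] (var i) ρ η = sym (trans (eval-var i (eval* ρ η)) (lookup-map ρ i))
  eval-[] (con c) ρ η = trans (eval-con c η) (sym (eval-con c (eval* ρ η)))
  eval-[] (s · t) ρ η = trans (eval-app (s [ ρ ]) (t [ ρ ]) η)
    (trans (cong₂ _⟨$⟩_ (eval-[] s ρ η) (eval-[] t ρ η)) (sym (eval-app s t (eval* ρ η))))

  eval*-[] : (ts : Tms C Γ σs) (ρ : Tms C Δ Γ) (η : Env Δ) →
             eval* (ts [ ρ ]*) η ≡ eval* ts (eval* ρ η)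
  eval*-[] ts ρ η = trans (map-∘ ts) (map-cong ts (λ t → eval-[] t ρ η))

  eval*-vars : (η : Env Γ) → eval* vars η ≡ η
  eval*-vars η = trans (map-tabulate _ var) (trans (tabulate-cong (λ i → eval-var i η)) (tabulate-lookup η))

  eval*-locals : ∀ τs (xs : Env τs) (η : Env Γ) → eval* (locals τs) (++⁺ xs η) ≡ xs
  eval*-locals τs xs η = trans (map-++⁻ˡ _ τs vars)
    (trans (cong (++⁻ˡ τs) (eval*-vars (++⁺ xs η))) (++⁻ˡ-++⁺ xs η))

  eval*-wk : ∀ τs (xs : Env τs) (η : Env Γ) → eval* (wk τs) (++⁺ xs η) ≡ η
  eval*-wk τs xs η = trans (map-++⁻ʳ _ τs vars)
    (trans (cong (++⁻ʳ τs) (eval*-vars (++⁺ xs η))) (++⁻ʳ-++⁺ xs η))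

  eval*-[wk] : ∀ τs (ts : Tms C Γ σs) (xs : Env τs) (η : Env Γ) →
               eval* (ts [ wk τs ]*) (++⁺ xs η) ≡ eval* ts η
  eval*-[wk] τs ts xs η = trans (eval*-[] ts (wk τs) _) (cong (eval* ts) (eval*-wk τs xs η))

  eval*-lift : ∀ τs (ρ : Tms C Δ Γ) (xs : Env τs) (η : Env Δ) →
               eval* (lift τs ρ) (++⁺ xs η) ≡ ++⁺ xs (eval* ρ η)
  eval*-lift τs ρ xs η = trans (map-++⁺ _ (locals τs) (ρ [ wk τs ]*))
    (cong₂ ++⁺ (eval*-locals τs xs η) (eval*-[wk] τs ρ xs η))

  eval-·* : (t : Tm C Γ (σs ⇒* τ)) (ss : Tms C Γ σs) (η : Env Γ) →
            eval (t ·* ss) η ≡ apply σs τ (eval t η) (eval* ss η)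
  eval-·* t []       η = refl
  eval-·* {τ = τ} t (s ∷ ss) η = trans (eval-·* (t · s) ss η)
    (cong (λ f → apply _ τ f (eval* ss η)) (eval-app t s η))

open Evaluation ⟦_⟧ᶜ eval (λ _ _ → refl) (λ _ _ → refl) (λ _ _ _ → refl)

module ᴴ = Evaluation (λ c → ⟦ embed c ⟧ᴴ) (λ t → eval (toTarget t))
             (λ _ _ → refl) (λ _ _ → refl) (λ _ _ _ → refl)

apply* : ∀ σs {τs} → Env (map (σs ⇒*_) τs) → Env σs → Env τs
apply* σs fs xs = All.map (λ {τ} f → apply σs τ f xs) (All-map⁻ fs)

eval*-·· : ∀ {τs} (ts : WTms Γ (map (σs ⇒*_) τs)) (ss : WTms Γ σs) (η : Env Γ) →
           eval* (_··_ {τs = τs} ts ss) η ≡ apply* σs {τs} (eval* ts η) (eval* ss η)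
eval*-·· {τs = []}    []       ss η = refl
eval*-·· {τs = _ ∷ _} (t ∷ ts) ss η = cong₂ _∷_ (eval-·* t ss η) (eval*-·· ts ss η)

-- Bracket abstraction, with Π and Σ as the combinators K and S; the identity is Σ Π Π.
lam : Tm TargetCon (σ ∷ Γ) τ → Tm TargetCon Γ (σ ⇒ τ)
lam {σ} x₀          =
  con (ha (Σᶜ {τ = σ} _ _ _)) · con (ha (Πᶜ _ _)) · con (ha (Πᶜ {τ = σ} _ _))
lam (var (there i)) = con (ha (Πᶜ _ _)) · var i
lam (con c)         = con (ha (Πᶜ _ _)) · con c
lam (s · t)         = con (ha (Σᶜ _ _ _)) · lam s · lam t

eval-lam : (t : Tm TargetCon (σ ∷ Γ) τ) (η : Env Γ) (x : ∣ σ ∣) →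
           eval (lam t) η ⟨$⟩ x ≡ eval t (x ∷ η)
eval-lam x₀              η x = refl
eval-lam (var (there i)) η x = refl
eval-lam (con c)         η x = refl
eval-lam (s · t)         η x = cong₂ _⟨$⟩_ (eval-lam s η x) (eval-lam t η x)

-- The arguments stand behind `Γ` in the context, as in a concatenation of tuples. The substitution
-- brings the first of them to the front, where `lam` can bind it.
lam* : ∀ σs → Tm TargetCon (Γ ++ σs) τ → Tm TargetCon Γ (σs ⇒* τ)
lam* {Γ} []       t = t [ ++⁺ vars [] ]
lam* {Γ} (σ ∷ σs) t =
  lam (lam* σs (t [ ++⁺ (++⁻ˡ Γ (wk (σ ∷ []))) (x₀ ∷ ++⁻ʳ Γ (wk (σ ∷ []))) ]))

eval-lam* : ∀ σs (t : Tm TargetCon (Γ ++ σs) τ) (η : Env Γ) (xs : Env σs) →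
            apply σs τ (eval (lam* σs t) η) xs ≡ eval t (++⁺ η xs)
eval-lam* {Γ} [] t η [] = trans (eval-[] t _ η) (cong (eval t)
  (trans (map-++⁺ _ vars []) (cong (λ η → ++⁺ η []) (eval*-vars η))))
eval-lam* {Γ} {τ} (σ ∷ σs) t η (x ∷ xs) = begin
  apply σs τ (eval (lam (lam* σs t′)) η ⟨$⟩ x) xs
    ≡⟨ cong (λ f → apply σs τ f xs) (eval-lam (lam* σs t′) η x) ⟩
  apply σs τ (eval (lam* σs t′) (x ∷ η)) xs
    ≡⟨ eval-lam* σs t′ (x ∷ η) xs ⟩
  eval t′ (x ∷ ++⁺ η xs)
    ≡⟨ eval-[] t ρ (x ∷ ++⁺ η xs) ⟩
  eval t (eval* ρ (x ∷ ++⁺ η xs))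
    ≡⟨ cong (eval t) (trans (map-++⁺ _ (++⁻ˡ Γ w) (x₀ ∷ ++⁻ʳ Γ w)) (cong₂ (λ ys zs → ++⁺ ys (x ∷ zs))
         (trans (map-++⁻ˡ _ Γ w) (trans (cong (++⁻ˡ Γ) w≡) (++⁻ˡ-++⁺ η xs)))
         (trans (map-++⁻ʳ _ Γ w) (trans (cong (++⁻ʳ Γ) w≡) (++⁻ʳ-++⁺ η xs))))) ⟩
  eval t (++⁺ η (x ∷ xs)) ∎
  where
  open ≡-Reasoning
  w : WTms (σ ∷ Γ ++ σs) (Γ ++ σs)
  w = wk (σ ∷ [])
  w≡ : eval* w (x ∷ ++⁺ η xs) ≡ ++⁺ η xs
  w≡ = eval*-wk (σ ∷ []) (x ∷ []) (++⁺ η xs)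
  ρ : WTms (σ ∷ Γ ++ σs) (Γ ++ σ ∷ σs)
  ρ = ++⁺ (++⁻ˡ Γ w) (x₀ ∷ ++⁻ʳ Γ w)
  t′ : Tm TargetCon (σ ∷ Γ ++ σs) _
  t′ = t [ ρ ]

-- Functions on tuples that are given by terms

record Definable (F : Env Γ → Env τs) : Set where
  constructor by
  field
    terms   : WTms Γ τs
    correct : ∀ η → eval* terms η ≡ F η

open Definable

infixr 9 _∘ᵈ_

idᵈ : Definable {Γ} id
idᵈ = by vars eval*-vars

_∘ᵈ_ : {F : Env Δ → Env Θ} {G : Env Γ → Env Δ} →
       Definable F → Definable G → Definable (F ∘ G)
_∘ᵈ_ {F = F} DF DG = by (terms DF [ terms DG ]*) λ η →
  trans (eval*-[] (terms DF) (terms DG) η)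
    (trans (correct DF _) (cong F (correct DG η)))

leftᵈ : ∀ Γ {Δ} → Definable (++⁻ˡ Γ {Δ})
leftᵈ Γ = by (++⁻ˡ Γ vars) λ η →
  trans (map-++⁻ˡ _ Γ vars) (cong (++⁻ˡ Γ) (eval*-vars η))

rightᵈ : ∀ Γ {Δ} → Definable (++⁻ʳ Γ {Δ})
rightᵈ Γ = by (++⁻ʳ Γ vars) λ η →
  trans (map-++⁻ʳ _ Γ vars) (cong (++⁻ʳ Γ) (eval*-vars η))

appendᵈ : {F : Env Γ → Env Δ} {G : Env Γ → Env Θ} →
          Definable F → Definable G → Definable (λ η → ++⁺ (F η) (G η))
appendᵈ F G = by (++⁺ (terms F) (terms G)) λ η →
  trans (map-++⁺ _ (terms F) (terms G)) (cong₂ ++⁺ (correct F η) (correct G η))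

joinᵈ : {F : Env Γ → Env (map _* σs)} {G : Env Γ → Env (map _* τs)} →
        Definable F → Definable G → Definable (λ η → join {σs = σs} {τs} (F η) (G η))
joinᵈ {σs = σs} F G = by (join {σs = σs} (terms F) (terms G)) λ η →
  trans (map-join _ {σs} (terms F) (terms G))
    (cong₂ (join {σs = σs}) (correct F η) (correct G η))

splitˡᵈ : ∀ σs {τs} {F : Env Γ → Env (map _* (σs ++ τs))} →
          Definable F → Definable (λ η → splitˡ σs {τs} (F η))
splitˡᵈ σs F = by (splitˡ σs (terms F)) λ η →
  trans (map-splitˡ _ σs (terms F)) (cong (splitˡ σs) (correct F η))

splitʳᵈ : ∀ σs {τs} {F : Env Γ → Env (map _* (σs ++ τs))} →
          Definable F → Definable (λ η → splitʳ σs {τs} (F η))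
splitʳᵈ σs F = by (splitʳ σs (terms F)) λ η →
  trans (map-splitʳ _ σs (terms F)) (cong (splitʳ σs) (correct F η))

apply*ᵈ : ∀ σs {τs} {F : Env Γ → Env (map (σs ⇒*_) τs)} {G : Env Γ → Env σs} →
          Definable F → Definable G → Definable (λ η → apply* σs {τs} (F η) (G η))
apply*ᵈ σs {τs} F G = by (_··_ {τs = τs} (terms F) (terms G)) λ η →
  trans (eval*-·· {τs = τs} (terms F) (terms G) η)
    (cong₂ (apply* σs {τs}) (correct F η) (correct G η))

-- A function of several tuples is definable if it is definable as a
-- function of their concatenation.
record Definable₂ (F : Env Γ → Env Δ → Env τs) : Set where
  constructor curried
  field
    uncurried : Definable (λ η → F (++⁻ˡ Γ {Δ} η) (++⁻ʳ Γ {Δ} η))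

open Definable₂

infix 8 _$₂_,_

_$₂_,_ : {F : Env Γ → Env Δ → Env τs} {G : Env Θ → Env Γ} {H : Env Θ → Env Δ} →
         Definable₂ F → Definable G → Definable H → Definable (λ η → F (G η) (H η))
_$₂_,_ {F = F} {G} {H} DF DG DH = by (terms D) λ η → trans (correct D η)
  (cong₂ F (++⁻ˡ-++⁺ (G η) (H η)) (++⁻ʳ-++⁺ (G η) (H η)))
  where
  D : Definable _
  D = uncurried DF ∘ᵈ appendᵈ DG DH

record Abstraction (F : Env Γ → Env σs → Env τs) : Set where
  field
    function  : Env Γ → Env (map (σs ⇒*_) τs)
    definable : Definable function
    β         : ∀ η xs → apply* σs {τs} (function η) xs ≡ F η xs

abstraction : {F : Env Γ → Env σs → Env τs} → Definable₂ F → Abstraction F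
abstraction {Γ} {σs} {τs} {F} D = record
  -- Taking the denotation of the terms as the function makes definability immediate and leaves only
  -- `β` to be proved.
  { function  = eval* (lams (terms (uncurried D)))
  ; definable = by (lams (terms (uncurried D))) λ _ → refl
  ; β         = λ η xs → trans (eval-lams (terms (uncurried D)) η xs)
      (trans (correct (uncurried D) (++⁺ η xs)) (cong₂ F (++⁻ˡ-++⁺ η xs) (++⁻ʳ-++⁺ η xs)))
  }
  where
  lams : WTms (Γ ++ σs) τs → WTms Γ (map (σs ⇒*_) τs)
  lams ts = All-map⁺ (All.map (lam* σs) ts)
  eval-lams : ∀ {τs} (ts : WTms (Γ ++ σs) τs) η xs →
              apply* σs {τs} (eval* (All-map⁺ (All.map (lam* σs) ts)) η) xs ≡ eval* ts (++⁺ η xs)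
  eval-lams []       η xs = refl
  eval-lams (t ∷ ts) η xs = cong₂ _∷_ (eval-lam* σs t η xs) (eval-lams ts η xs)

-- These closed terms fill sets of negative witnesses from which nothing is demanded, since a finite
-- set here is never empty.
default : ∀ σ → Tm TargetCon Γ σ
default nat     = con (ha zeroᶜ)
default bool    = con (ha 0ᴮ)
default (σ ⇒ τ) = con (ha (Πᶜ _ _)) · default τ
default (σ *)   = con singᶜ · default σ

default* : ∀ τs → WTms Γ τs
default* τs = All.tabulate (λ _ → default _)

constᵈ : (ts : WTms [] τs) → Definable {Γ} (λ _ → eval* ts [])
constᵈ ts = by (ts [ [] ]*) (eval*-[] ts [])

-- Finite sets of tuples of witnesses

In : ∀ τ → ∣ τ ∣ → ∣ τ * ∣ → Set
In τ = FiniteSubsets._∈ˢ_ ⟦ τ ⟧ᵀ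

infix 4 _∈*_

-- A tuple of sets stands for the product of its components, so that `join` forms products and the
-- splittings project from them.
_∈*_ : Env τs → Env (map _* τs) → Set
_∈*_ {[]}     []       []       = ⊤
_∈*_ {τ ∷ τs} (x ∷ xs) (X ∷ Xs) = In τ x X × xs ∈* Xs

∈*-inhabited : ∀ {τs} (Xs : Env (map _* τs)) → Σ[ xs ∈ Env τs ] xs ∈* Xs
∈*-inhabited {[]}     []             = [] , tt
∈*-inhabited {τ ∷ τs} ((x ∷ X) ∷ Xs) with ∈*-inhabited Xs
... | xs , p = x ∷ xs , here (Setoid.refl ⟦ τ ⟧ᵀ) , p

∈*-join : ∀ {σs τs} {xs : Env σs} {ys : Env τs} {Xs Ys} →
          xs ∈* Xs → ys ∈* Ys → ++⁺ xs ys ∈* join {σs = σs} Xs Ys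
∈*-join {[]}     {xs = []}    {Xs = []}    p       q = q
∈*-join {_ ∷ σs} {xs = _ ∷ _} {Xs = _ ∷ _} (p , r) q = p , ∈*-join {σs} r q

∈*-splitˡ : ∀ σs {τs} {xs : Env (σs ++ τs)} {Xs} →
            xs ∈* Xs → ++⁻ˡ σs xs ∈* splitˡ σs Xs
∈*-splitˡ []                               p       = tt
∈*-splitˡ (_ ∷ σs) {xs = _ ∷ _} {Xs = _ ∷ _} (p , q) = p , ∈*-splitˡ σs q

∈*-splitʳ : ∀ σs {τs} {xs : Env (σs ++ τs)} {Xs} →
            xs ∈* Xs → ++⁻ʳ σs xs ∈* splitʳ σs Xs
∈*-splitʳ []                               p       = p
∈*-splitʳ (_ ∷ σs) {xs = _ ∷ _} {Xs = _ ∷ _} (p , q) = ∈*-splitʳ σs q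

sing* : ∀ {τs} → Env τs → Env (map _* τs)
sing* xs = All-map⁺ (All.map (λ {τ} x → SetOperations.sing τ ⟨$⟩ x) xs)

sing*ᵈ : {F : Env Γ → Env τs} → Definable F → Definable (λ η → sing* (F η))
sing*ᵈ {Γ} {F = F} D = by (ts (terms D)) λ η → trans (correct-ts (terms D) η) (cong sing* (correct D η))
  where
  ts : ∀ {τs} → WTms Γ τs → WTms Γ (map _* τs)
  ts us = All-map⁺ (All.map (con singᶜ ·_) us)
  correct-ts : ∀ {τs} (us : WTms Γ τs) η → eval* (ts us) η ≡ sing* (eval* us η)
  correct-ts []       η = refl
  correct-ts (u ∷ us) η = cong (_ ∷_) (correct-ts us η)

∈*-sing : ∀ {τs} (xs : Env τs) → xs ∈* sing* xs
∈*-sing []                = tt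
∈*-sing {τ ∷ τs} (x ∷ xs) = here (Setoid.refl ⟦ τ ⟧ᵀ) , ∈*-sing xs

infixr 6 _∪*_

_∪*_ : ∀ {τs} → Env (map _* τs) → Env (map _* τs) → Env (map _* τs)
_∪*_ {[]}     []       []       = []
_∪*_ {τ ∷ τs} (X ∷ Xs) (Y ∷ Ys) = (SetOperations.∪ τ ⟨$⟩ X ⟨$⟩ Y) ∷ _∪*_ {τs} Xs Ys

∪*ᵈ : ∀ {τs} {F G : Env Γ → Env (map _* τs)} → Definable F → Definable G →
      Definable (λ η → _∪*_ {τs} (F η) (G η))
∪*ᵈ {Γ} {τs} DF DG = by (ts (terms DF) (terms DG)) λ η →
  trans (correct-ts (terms DF) (terms DG) η) (cong₂ (_∪*_ {τs}) (correct DF η) (correct DG η))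
  where
  ts : ∀ {τs} → WTms Γ (map _* τs) → WTms Γ (map _* τs) → WTms Γ (map _* τs)
  ts {[]}     []       []       = []
  ts {τ ∷ τs} (X ∷ Xs) (Y ∷ Ys) = (con ∪ᶜ · X · Y) ∷ ts Xs Ys
  correct-ts : ∀ {τs} (Xs Ys : WTms Γ (map _* τs)) η →
               eval* (ts {τs} Xs Ys) η ≡ _∪*_ {τs} (eval* Xs η) (eval* Ys η)
  correct-ts {[]}     []       []       η = refl
  correct-ts {τ ∷ τs} (X ∷ Xs) (Y ∷ Ys) η = cong (_ ∷_) (correct-ts {τs} Xs Ys η)

∈*-∪ˡ : ∀ {τs} {xs : Env τs} {Xs Ys} → xs ∈* Xs → xs ∈* Xs ∪* Ys
∈*-∪ˡ {[]}     {[]}     {[]}     {[]}     p       = tt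
∈*-∪ˡ {τ ∷ τs} {x ∷ xs} {X ∷ Xs} {Y ∷ Ys} (p , q) = Any.++⁺ˡ p , ∈*-∪ˡ {τs} q

∈*-∪ʳ : ∀ {τs} {xs : Env τs} {Xs Ys} → xs ∈* Ys → xs ∈* Xs ∪* Ys
∈*-∪ʳ {[]}     {[]}     {[]}     {[]}     p       = tt
∈*-∪ʳ {τ ∷ τs} {x ∷ xs} {X ∷ Xs} {Y ∷ Ys} (p , q) = Any.++⁺ʳ (toList X) p , ∈*-∪ʳ {τs} q

∈-⋃ : ∀ {x y} (X : ∣ σ * ∣) (f : ∣ σ ⇒ τ * ∣) → In σ x X →
      In τ y (f ⟨$⟩ x) →
      In τ y (SetOperations.⋃ σ τ ⟨$⟩ X ⟨$⟩ f)
∈-⋃ {σ} {τ} {x} {y} X f x∈X y∈fx =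
  subst (y ∈ᵀ_) (sym (SetOperations.toList-concatMap (f ⟨$⟩_) X))
    (Any.concatMap⁺ (toList ∘ (f ⟨$⟩_))
      (Any.map (λ x≈z → proj₁ (Func.cong f x≈z) y∈fx) x∈X))
  where open SetoidMembership ⟦ τ ⟧ᵀ using () renaming (_∈_ to _∈ᵀ_)

⋃ᵗ : ∀ {Γ} σs → WTms Γ (map _* σs) → Tm TargetCon Γ (σs ⇒* τ *) → Tm TargetCon Γ (τ *)
⋃ᵗ []       []       f = f
⋃ᵗ (σ ∷ σs) (B ∷ Bs) f =
  con ⋃ᶜ · B · lam (⋃ᵗ σs (Bs [ wk (σ ∷ []) ]*) (f [ wk (σ ∷ []) ] · x₀))

∈-⋃ᵗ : ∀ {Γ} σs (Bs : WTms Γ (map _* σs)) (f : Tm TargetCon Γ (σs ⇒* τ *)) η {xs y} →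
       xs ∈* eval* Bs η → In τ y (apply σs (τ *) (eval f η) xs) →
       In τ y (eval (⋃ᵗ σs Bs f) η)
∈-⋃ᵗ []       []       f η {[]} p q = q
∈-⋃ᵗ {τ} (σ ∷ σs) (B ∷ Bs) f η {x ∷ xs} {y} (p , ps) q =
  ∈-⋃ {σ} {τ} {x} {y} (eval B η) (eval (lam u) η) p
    (subst (In τ y) (sym (eval-lam u η x))
      (∈-⋃ᵗ σs (Bs [ w ]*) (f [ w ] · x₀) (x ∷ η)
        (subst (xs ∈*_) (sym (eval*-[wk] (σ ∷ []) Bs (x ∷ []) η)) ps)
        (subst (λ g → In τ y (apply σs (τ *) (g ⟨$⟩ x) xs))
          (sym (trans (eval-[] f w (x ∷ η)) (cong (eval f) (eval*-wk (σ ∷ []) (x ∷ []) η)))) q)))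
  where
  w : WTms (σ ∷ _) _
  w = wk (σ ∷ [])
  u : Tm TargetCon (σ ∷ _) (τ *)
  u = ⋃ᵗ σs (Bs [ w ]*) (f [ w ] · x₀)

-- One inclusion suffices. Unions taken in each component may contain tuples that lie in no single
-- `F η xs`. This is harmless, because a larger set of negative witnesses only strengthens the
-- premise of an entailment.
record Union (B : Env Γ → Env (map _* σs)) (F : Env Γ → Env σs → Env (map _* τs)) : Set where
  field
    union     : Env Γ → Env (map _* τs)
    definable : Definable union
    ∈-union   : ∀ η {xs ys} → xs ∈* B η → ys ∈* F η xs → ys ∈* union η

unionᵈ : {B : Env Γ → Env (map _* σs)} {F : Env Γ → Env σs → Env (map _* τs)} →
         Definable B → Definable₂ F → Union {σs = σs} {τs} B F
unionᵈ {Γ} {σs} {τs} {B} {F} DB DF = record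
  { union     = eval* (ts τs (terms L.definable))
  ; definable = by (ts τs (terms L.definable)) λ _ → refl
  ; ∈-union   = λ η {xs} {ys} p q →
      ∈-ts τs (terms L.definable) η (subst (xs ∈*_) (sym (correct DB η)) p)
        (subst (ys ∈*_)
          (sym (trans (cong (λ f → apply* σs {map _* τs} f xs) (correct L.definable η)) (L.β η xs))) q)
  }
  where
  module L = Abstraction (abstraction {σs = σs} {map _* τs} {F} DF)
  ts : ∀ τs → WTms Γ (map (σs ⇒*_) (map _* τs)) → WTms Γ (map _* τs)
  ts []       []       = []
  ts (τ ∷ τs) (f ∷ fs) = ⋃ᵗ σs (terms DB) f ∷ ts τs fs
  ∈-ts : ∀ τs (fs : WTms Γ (map (σs ⇒*_) (map _* τs))) η {xs ys} →
         xs ∈* eval* (terms DB) η → ys ∈* apply* σs {map _* τs} (eval* fs η) xs →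
         ys ∈* eval* (ts τs fs) η
  ∈-ts []       []       η {xs} {[]}    p q       = tt
  ∈-ts (τ ∷ τs) (f ∷ fs) η {xs} {_ ∷ _} p (q , r) = ∈-⋃ᵗ σs (terms DB) f η p q , ∈-ts τs fs η p r

-- Recursion and case distinction on tuples

apply-curry : ∀ σs {τ} (F : Func (Tuple σs) ⟦ τ ⟧ᵀ) xs →
              apply σs τ (curry σs τ F) xs ≡ F ⟨$⟩ xs
apply-curry []           F []       = refl
apply-curry (σ ∷ σs) {τ} F (x ∷ xs) = apply-curry σs (fix-head τ F x) xs

Steps : List Ty → List Ty
Steps σs = map (Step σs) σs

eval-rec : ∀ {σs σ} (i : σ ∈ σs) n (w : Env σs) (f : Env (Steps σs)) →
           apply (Steps σs) σ (apply σs _ (Recursor.recᴰ σs i ⟨$⟩ n) w) f ≡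
           All.lookup (Recursor.rec σs n w f) i
eval-rec {σs} {σ} i n w f = trans
  (cong (λ g → apply (Steps σs) σ g f) (apply-curry σs _ w))
  (apply-curry (Steps σs) _ f)

rec-suc-apply* : ∀ σs n (w : Env σs) (f : Env (Steps σs)) →
                 Recursor.rec σs (suc n) w f ≡ apply* (nat ∷ σs) {σs} f (n ∷ Recursor.rec σs n w f)
rec-suc-apply* σs n w f = tabulate-apply f (Recursor.rec σs n w f)
  where
  tabulate-apply : ∀ {τs} (f : Env (map (Step σs) τs)) (xs : Env σs) →
    All.tabulate {xs = τs} (λ {σ} i → apply σs σ (All.lookup f (∈-map⁺ (Step σs) i) ⟨$⟩ n) xs)
    ≡ apply* (nat ∷ σs) {τs} f (n ∷ xs)
  tabulate-apply {[]}    []      xs = refl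
  tabulate-apply {_ ∷ _} (g ∷ f) xs = cong (_ ∷_) (tabulate-apply f xs)

eval-last : ∀ Γ (η : Env (Γ ++ σ ∷ [])) →
            eval (All.head (++⁻ʳ Γ vars)) η ≡ All.head (++⁻ʳ Γ η)
eval-last Γ η = trans (eval-head (++⁻ʳ Γ vars)) (cong All.head (correct (rightᵈ Γ) η))
  where
  eval-head : (ts : WTms Δ (σ ∷ σs)) {η : Env Δ} → eval (All.head ts) η ≡ All.head (eval* ts η)
  eval-head (t ∷ ts) = refl

-- The order of arguments is that of the positive witnesses in `ℕ-induction`: those of the
-- hypothesis `H`, then the number witnessing 𝓘_ℕ, then those of the induction hypothesis.
record Recursion (F : Env Γ → Env σs) (G : Env ((Γ ++ nat ∷ []) ++ σs) → Env σs) : Set where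
  field
    function  : Env (Γ ++ nat ∷ []) → Env σs
    definable : Definable function
    at-zero   : ∀ η → function (++⁺ η (0 ∷ [])) ≡ F η
    at-suc    : ∀ η n → function (++⁺ η (suc n ∷ [])) ≡
                G (++⁺ (++⁺ η (n ∷ [])) (function (++⁺ η (n ∷ []))))

recursion : {F : Env Γ → Env σs} {G : Env ((Γ ++ nat ∷ []) ++ σs) → Env σs} →
            Definable F → Definable G → Recursion F G
recursion {Γ} {σs} {F} {G} DF DG = record
  { function  = λ η → r (All.head (++⁻ʳ Γ η)) (++⁻ˡ Γ η)
  ; definable = by (All.tabulate λ i → rᵗ i ·* terms w ·* terms h) λ η →
      trans (map-tabulate _ _) (trans (tabulate-cong (λ i → correct-i i η)) (tabulate-lookup _))
  ; at-zero   = λ η → cong₂ r (cong All.head (++⁻ʳ-++⁺ η (0 ∷ []))) (++⁻ˡ-++⁺ η (0 ∷ []))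
  ; at-suc    = λ η n → trans
      (cong₂ r (cong All.head (++⁻ʳ-++⁺ η (suc n ∷ []))) (++⁻ˡ-++⁺ η (suc n ∷ [])))
      (trans (rec-suc-apply* σs n (F η) (L.function η))
        (trans (L.β η (n ∷ r n η))
          (cong (λ xs → G (++⁺ (++⁺ η (n ∷ [])) xs))
            (sym (cong₂ r (cong All.head (++⁻ʳ-++⁺ η (n ∷ []))) (++⁻ˡ-++⁺ η (n ∷ [])))))))
  }
  where
  step : Env Γ → Env (nat ∷ σs) → Env σs
  step η xs = G (++⁺ (++⁺ η (++⁻ˡ (nat ∷ []) xs)) (++⁻ʳ (nat ∷ []) xs))
  stepᵈ : Definable₂ step
  stepᵈ = curried (DG ∘ᵈ appendᵈ (appendᵈ (leftᵈ Γ) (leftᵈ (nat ∷ []) ∘ᵈ rightᵈ Γ))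
                                 (rightᵈ (nat ∷ []) ∘ᵈ rightᵈ Γ))
  module L = Abstraction (abstraction {F = step} stepᵈ)
  r : ℕ → Env Γ → Env σs
  r n η = Recursor.rec σs n (F η) (L.function η)
  w : Definable (F ∘ ++⁻ˡ Γ {nat ∷ []})
  w = DF ∘ᵈ leftᵈ Γ
  h : Definable (L.function ∘ ++⁻ˡ Γ {nat ∷ []})
  h = L.definable ∘ᵈ leftᵈ Γ
  rᵗ : ∀ {σ} → σ ∈ σs → Tm TargetCon (Γ ++ nat ∷ []) (σs ⇒* (Steps σs ⇒* σ))
  rᵗ i = con (ha (recᶜ (All.tabulate (λ _ → tt)) i)) · All.head (++⁻ʳ Γ vars)
  correct-i : ∀ {σ} (i : σ ∈ σs) η →
    eval (rᵗ i ·* terms w ·* terms h) η ≡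
    All.lookup (r (All.head (++⁻ʳ Γ η)) (++⁻ˡ Γ η)) i
  correct-i {σ} i η = begin
    eval (rᵗ i ·* terms w ·* terms h) η
      ≡⟨ eval-·* (rᵗ i ·* terms w) (terms h) η ⟩
    apply (Steps σs) σ (eval (rᵗ i ·* terms w) η) (eval* (terms h) η)
      ≡⟨ cong (λ g → apply (Steps σs) σ g (eval* (terms h) η)) (eval-·* (rᵗ i) (terms w) η) ⟩
    apply (Steps σs) σ (apply σs _ (Recursor.recᴰ σs i ⟨$⟩ n) (eval* (terms w) η)) (eval* (terms h) η)
      ≡⟨ eval-rec i n (eval* (terms w) η) (eval* (terms h) η) ⟩
    All.lookup (Recursor.rec σs n (eval* (terms w) η) (eval* (terms h) η)) i
      ≡⟨ cong₂ (λ ws hs → All.lookup (Recursor.rec σs n ws hs) i) (correct w η) (correct h η) ⟩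
    All.lookup (r n (++⁻ˡ Γ η)) i
      ≡⟨ cong (λ n → All.lookup (r n (++⁻ˡ Γ η)) i) (eval-last Γ η) ⟩
    All.lookup (r (All.head (++⁻ʳ Γ η)) (++⁻ˡ Γ η)) i ∎
    where
    open ≡-Reasoning
    n : ℕ
    n = eval (All.head (++⁻ʳ Γ vars)) η

caseᵈ : {F G : Env Γ → Env τs} → Definable F → Definable G →
        Definable {Γ ++ bool ∷ []} (λ η → if All.head (++⁻ʳ Γ η) then G (++⁻ˡ Γ η) else F (++⁻ˡ Γ η))
caseᵈ {Γ} DF DG = by (ts (terms F′) (terms G′)) λ η →
  trans (correct-ts (terms F′) (terms G′) η)
    (trans (cong (λ b → if b then eval* (terms G′) η else eval* (terms F′) η) (eval-last Γ η))
      (cong₂ (λ xs ys → if All.head (++⁻ʳ Γ η) then ys else xs) (correct F′ η) (correct G′ η)))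
  where
  F′ = DF ∘ᵈ leftᵈ Γ {bool ∷ []}
  G′ = DG ∘ᵈ leftᵈ Γ {bool ∷ []}
  ts : ∀ {τs} → WTms (Γ ++ bool ∷ []) τs → WTms (Γ ++ bool ∷ []) τs → WTms (Γ ++ bool ∷ []) τs
  ts []       []       = []
  ts (s ∷ ss) (t ∷ us) = (con (ha (condᶜ _)) · All.head (++⁻ʳ Γ vars) · s · t) ∷ ts ss us
  if-∷ : ∀ {τ τs} b {x y : ∣ τ ∣} {xs ys : Env τs} →
         _∷_ {P = ∣_∣} {x = τ} (if b then y else x) (if b then ys else xs) ≡
         (if b then y ∷ ys else x ∷ xs)
  if-∷ false = refl
  if-∷ true  = refl
  correct-ts : ∀ {τs} (ss us : WTms (Γ ++ bool ∷ []) τs) η →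
    eval* (ts ss us) η ≡ (if eval (All.head (++⁻ʳ Γ vars)) η then eval* us η else eval* ss η)
  correct-ts []       []       η with eval (All.head (++⁻ʳ Γ vars)) η
  ... | false = refl
  ... | true  = refl
  correct-ts (s ∷ ss) (u ∷ us) η =
    trans (cong (_ ∷_) (correct-ts ss us η)) (if-∷ (eval (All.head (++⁻ʳ Γ vars)) η))

-- Entailment between families of interpreted formulas

-- As in the Diller–Nahm variant of the Dialectica interpretation, backward
-- yields finitely many negative witnesses of the premise that suffice for a
-- given negative witness of the conclusion.
record Entails {X : Set} (p n : List Ty) (R : X → Env p → Env n → Set)
               (p′ n′ : List Ty) (R′ : X → Env p′ → Env n′ → Set) : Set where
  field
    forward   : Env p → Env p′
    backward  : Env p → Env n′ → Env (map _* n)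
    forwardᵈ  : Definable forward
    backwardᵈ : Definable₂ backward
    sound     : ∀ x a d → (∀ {b} → b ∈* backward a d → R x a b) → R′ x (forward a) d

weaken : ∀ {X p n} {R R′ : X → Env p → Env n → Set} →
         (∀ x a b → R x a b → R′ x a b) → Entails p n R p n R′
weaken {p = p} R⊆R′ = record
  { forward   = id
  ; backward  = λ _ → sing*
  ; forwardᵈ  = idᵈ
  ; backwardᵈ = curried (sing*ᵈ (rightᵈ p))
  ; sound     = λ x a d h → R⊆R′ x a d (h (∈*-sing d))
  }

same : ∀ {X p n} {R : X → Env p → Env n → Set} → Entails p n R p n R
same = weaken (λ _ _ _ r → r)

-- Without η-equality the connectives below are rigid, so that problems can be
-- inferred from entailments between them.  The price is that problems with
-- equal components are only related by ⟨ same ⟩.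
record Problem (X : Set) : Set₁ where
  no-eta-equality
  field
    pos neg  : List Ty
    realized : X → Env pos → Env neg → Set

open Problem

infix 3 _⊢_

record _⊢_ {X} (P Q : Problem X) : Set where
  constructor ⟨_⟩
  field
    entails : Entails (pos P) (neg P) (realized P) (pos Q) (neg Q) (realized Q)
  open Entails entails public

open _⊢_

private
  variable
    X Y : Set
    P P′ Q Q′ S H : Problem X

⊢-refl : (P : Problem X) → P ⊢ P
⊢-refl P = ⟨ same ⟩

-- Connectives and quantifiers on problems

infixr 6 _∧ˢ_
infixr 5 _⇒ˢ_
infixl 8 _⟪_⟫

_⟪_⟫ : Problem X → (Y → X) → Problem Y
pos (P ⟪ u ⟫) = pos P
neg (P ⟪ u ⟫) = neg P
realized (P ⟪ u ⟫) = realized P ∘ u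

⊤ˢ : Problem X
pos ⊤ˢ = []
neg ⊤ˢ = []
realized ⊤ˢ _ _ _ = ⊤

_∧ˢ_ : Problem X → Problem X → Problem X
pos (P ∧ˢ Q) = pos P ++ pos Q
neg (P ∧ˢ Q) = neg P ++ neg Q
realized (P ∧ˢ Q) x a b = realized P x (++⁻ˡ (pos P) a) (++⁻ˡ (neg P) b) ×
                          realized Q x (++⁻ʳ (pos P) a) (++⁻ʳ (neg P) b)

_⇒ˢ_ : Problem X → Problem X → Problem X
pos (P ⇒ˢ Q) = Arrow.pos (pos P) (neg P) (pos Q) (neg Q)
neg (P ⇒ˢ Q) = Arrow.neg (pos P) (neg P) (pos Q) (neg Q)
realized (P ⇒ˢ Q) x fg ad =
  (∀ {b} → b ∈* apply* neg-⇒ {map _* (neg P)} (++⁻ʳ 𝐟-types fg) ad → realized P x (++⁻ˡ (pos P) ad) b) →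
  realized Q x (apply* (pos P) {pos Q} (++⁻ˡ 𝐟-types fg) (++⁻ˡ (pos P) ad)) (++⁻ʳ (pos P) ad)
  where open Arrow (pos P) (neg P) (pos Q) (neg Q) using (𝐟-types) renaming (neg to neg-⇒)

∀ˢ ∃ˢ : Problem (Y × X) → Problem X
pos (∀ˢ P) = pos P
neg (∀ˢ P) = neg P
realized (∀ˢ P) x a b = ∀ y → realized P (y , x) a b
pos (∃ˢ P) = pos P
neg (∃ˢ P) = map _* (neg P)
realized (∃ˢ P) x a B = Σ[ y ∈ _ ] (∀ {b} → b ∈* B → realized P (y , x) a b)

-- Rules of intuitionistic logic

reindex : (u : Y → X) → P ⊢ Q → P ⟪ u ⟫ ⊢ Q ⟪ u ⟫
reindex u ⟨ D ⟩ = ⟨ record { Entails D hiding (sound) ; sound = λ y → Entails.sound D (u y) } ⟩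

infixr 4 _⨾_

_⨾_ : P ⊢ Q → Q ⊢ S → P ⊢ S
_⨾_ {P = P} {Q} {S} D E = ⟨ record
  { forward   = forward E ∘ forward D
  ; backward  = λ a d → U.union (++⁺ a d)
  ; forwardᵈ  = forwardᵈ E ∘ᵈ forwardᵈ D
  ; backwardᵈ = curried (U.definable ∘ᵈ appendᵈ (leftᵈ (pos P)) (rightᵈ (pos P)))
  ; sound     = λ x a d h → sound E x (forward D a) d λ {b} p → sound D x a b λ q →
      h (U.∈-union (++⁺ a d)
        (subst (λ (a , d) → b ∈* backward E (forward D a) d)
          (sym (cong₂ _,_ (++⁻ˡ-++⁺ a d) (++⁻ʳ-++⁺ a d))) p)
        (subst (λ a → _ ∈* backward D a b) (sym (++⁻ˡ-++⁺ a d)) q))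
  } ⟩
  where
  module U = Union (unionᵈ {σs = neg Q} {neg P}
    {B = λ η → backward E (forward D (++⁻ˡ (pos P) η)) (++⁻ʳ (pos P) {neg S} η)}
    {F = λ η → backward D (++⁻ˡ (pos P) η)}
    (backwardᵈ E $₂ forwardᵈ D ∘ᵈ leftᵈ (pos P) , rightᵈ (pos P))
    (curried (backwardᵈ D $₂ leftᵈ (pos P) ∘ᵈ leftᵈ (pos P ++ neg S) , rightᵈ (pos P ++ neg S))))

∧-intro : P ⊢ Q → P ⊢ S → P ⊢ Q ∧ˢ S
∧-intro {P = P} {Q} {S} D E = ⟨ record
  { forward   = λ a → ++⁺ (forward D a) (forward E a)
  ; backward  = λ a d → _∪*_ {neg P} (backward D a (++⁻ˡ (neg Q) d)) (backward E a (++⁻ʳ (neg Q) d))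
  ; forwardᵈ  = appendᵈ (forwardᵈ D) (forwardᵈ E)
  ; backwardᵈ = curried (∪*ᵈ {τs = neg P}
      (backwardᵈ D $₂ leftᵈ (pos P) , leftᵈ (neg Q) ∘ᵈ rightᵈ (pos P))
      (backwardᵈ E $₂ leftᵈ (pos P) , rightᵈ (neg Q) ∘ᵈ rightᵈ (pos P)))
  ; sound     = λ x a d h →
      subst (λ c → realized Q x c _) (sym (++⁻ˡ-++⁺ (forward D a) (forward E a)))
        (sound D x a _ λ p → h (∈*-∪ˡ {neg P} p)) ,
      subst (λ c → realized S x c _) (sym (++⁻ʳ-++⁺ (forward D a) (forward E a)))
        (sound E x a _ λ p → h (∈*-∪ʳ {neg P} p))
  } ⟩

-- Sets are non-empty, so the set for the conjunct that is not needed holds an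
-- arbitrary element.
fst : P ∧ˢ Q ⊢ P
fst {P = P} {Q} = ⟨ record
  { forward   = ++⁻ˡ (pos P)
  ; backward  = λ _ d → join {σs = neg P} (sing* d) (sing* (eval* (default* (neg Q)) []))
  ; forwardᵈ  = leftᵈ (pos P)
  ; backwardᵈ = curried (joinᵈ {σs = neg P}
      (sing*ᵈ (rightᵈ (pos P ++ pos Q))) (sing*ᵈ (constᵈ (default* (neg Q)))))
  ; sound     = λ x a d h → subst (realized P x _) (++⁻ˡ-++⁺ d _)
      (proj₁ (h (∈*-join {σs = neg P} (∈*-sing d) (∈*-sing _))))
  } ⟩

snd : P ∧ˢ Q ⊢ Q
snd {P = P} {Q} = ⟨ record
  { forward   = ++⁻ʳ (pos P)
  ; backward  = λ _ d → join {σs = neg P} (sing* (eval* (default* (neg P)) [])) (sing* d)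
  ; forwardᵈ  = rightᵈ (pos P)
  ; backwardᵈ = curried (joinᵈ {σs = neg P}
      (sing*ᵈ (constᵈ (default* (neg P)))) (sing*ᵈ (rightᵈ (pos P ++ pos Q))))
  ; sound     = λ x a d h → subst (realized Q x _) (++⁻ʳ-++⁺ (eval* (default* (neg P)) []) d)
      (proj₂ (h (∈*-join {σs = neg P} (∈*-sing _) (∈*-sing d))))
  } ⟩

∧-realized : ∀ {x a c b} → realized P x a (++⁻ˡ (neg P) b) → realized Q x c (++⁻ʳ (neg P) b) →
             realized (P ∧ˢ Q) x (++⁺ a c) b
∧-realized {P = P} {Q} {x} {a} {c} r s =
  subst (λ a → realized P x a _) (sym (++⁻ˡ-++⁺ a c)) r ,
  subst (λ c → realized Q x c _) (sym (++⁻ʳ-++⁺ a c)) s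

-- Currying: the negative witnesses that `D` asks for split into a part for `P`, which is passed on
-- to the premise, and a part for `Q`, which becomes the witness 𝐠 of the implication.
⇒-intro : P ∧ˢ Q ⊢ S → P ⊢ Q ⇒ˢ S
⇒-intro {P = P} {Q} {S} D = ⟨ record
  { forward   = λ a → ++⁺ (F.function a) (G.function a)
  ; backward  = λ a cd → splitˡ (neg P) (backward D (++⁺ a (++⁻ˡ (pos Q) cd)) (++⁻ʳ (pos Q) cd))
  ; forwardᵈ  = appendᵈ F.definable G.definable
  ; backwardᵈ = curried (splitˡᵈ (neg P) Gᵈ)
  ; sound     = λ x a cd h k →
      subst (λ c → realized S x c (++⁻ʳ (pos Q) cd))
        (sym (trans (cong (λ f → apply* (pos Q) {pos S} f (++⁻ˡ (pos Q) cd))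
                          (++⁻ˡ-++⁺ (F.function a) (G.function a)))
                    (F.β a (++⁻ˡ (pos Q) cd))))
        (sound D x (++⁺ a (++⁻ˡ (pos Q) cd)) (++⁻ʳ (pos Q) cd) λ p →
          ∧-realized {P = P} {Q} (h (∈*-splitˡ (neg P) p))
            (k (subst (_ ∈*_)
              (sym (trans (cong (λ g → apply* (pos Q ++ neg S) {map _* (neg Q)} g cd)
                                (++⁻ʳ-++⁺ (F.function a) (G.function a)))
                          (G.β a cd)))
              (∈*-splitʳ (neg P) p))))
  } ⟩
  where
  Gᵈ : Definable {pos P ++ pos Q ++ neg S} λ η → let cd = ++⁻ʳ (pos P) η in
       backward D (++⁺ (++⁻ˡ (pos P) η) (++⁻ˡ (pos Q) cd)) (++⁻ʳ (pos Q) cd)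
  Gᵈ = backwardᵈ D $₂ appendᵈ (leftᵈ (pos P)) (leftᵈ (pos Q) ∘ᵈ rightᵈ (pos P))
                    , rightᵈ (pos Q) ∘ᵈ rightᵈ (pos P)
  module F = Abstraction (abstraction {pos P} {pos Q} {pos S} {λ a c → forward D (++⁺ a c)}
    (curried (forwardᵈ D ∘ᵈ appendᵈ (leftᵈ (pos P)) (rightᵈ (pos P)))))
  module G = Abstraction (abstraction {pos P} {pos Q ++ neg S} {map _* (neg Q)}
    {λ a cd → splitʳ (neg P) (backward D (++⁺ a (++⁻ˡ (pos Q) cd)) (++⁻ʳ (pos Q) cd))}
    (curried (splitʳᵈ (neg P) Gᵈ)))

⇒-elim : P ⊢ Q ⇒ˢ S → P ⊢ Q → P ⊢ S
⇒-elim {P = P} {Q} {S} D E = ⟨ record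
  { forward   = λ a → apply* (pos Q) {pos S} (F a) (forward E a)
  -- The first set is what `D` asks for when the implication is used at the witness of `Q` computed
  -- by `E`. The second collects what `E` asks for, over all negative witnesses of `Q` that the
  -- implication demands there.
  ; backward  = λ a d → _∪*_ {neg P} (backward D a (++⁺ (forward E a) d)) (U.union (++⁺ a d))
  ; forwardᵈ  = apply*ᵈ (pos Q) {pos S} Fᵈ (forwardᵈ E)
  ; backwardᵈ = curried (∪*ᵈ {τs = neg P} (backwardᵈ D $₂ leftᵈ (pos P) , cdᵈ)
                                          (U.definable ∘ᵈ appendᵈ (leftᵈ (pos P)) (rightᵈ (pos P))))
  ; sound     = λ x a d h →
      subst₂ (λ c d → realized S x (apply* (pos Q) {pos S} (F a) c) d)
        (++⁻ˡ-++⁺ (forward E a) d) (++⁻ʳ-++⁺ (forward E a) d)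
        (sound D x a (++⁺ (forward E a) d) (λ p → h (∈*-∪ˡ {neg P} p)) λ {b} p →
          subst (λ c → realized Q x c b) (sym (++⁻ˡ-++⁺ (forward E a) d))
            (sound E x a b λ q → h (∈*-∪ʳ {neg P} (U.∈-union (++⁺ a d)
              (subst (λ (a , d) → b ∈* G a (++⁺ (forward E a) d))
                (sym (cong₂ _,_ (++⁻ˡ-++⁺ a d) (++⁻ʳ-++⁺ a d))) p)
              (subst (λ a → _ ∈* backward E a b) (sym (++⁻ˡ-++⁺ a d)) q)))))
  } ⟩
  where
  open Arrow (pos Q) (neg Q) (pos S) (neg S) using (𝐟-types)
  F : Env (pos P) → Env (map (pos Q ⇒*_) (pos S))
  F a = ++⁻ˡ 𝐟-types (forward D a)
  Fᵈ : Definable F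
  Fᵈ = leftᵈ 𝐟-types ∘ᵈ forwardᵈ D
  G : Env (pos P) → Env (pos Q ++ neg S) → Env (map _* (neg Q))
  G a = apply* (pos Q ++ neg S) {map _* (neg Q)} (++⁻ʳ 𝐟-types (forward D a))
  cdᵈ : Definable {pos P ++ neg S} (λ η → ++⁺ (forward E (++⁻ˡ (pos P) η)) (++⁻ʳ (pos P) η))
  cdᵈ = appendᵈ (forwardᵈ E ∘ᵈ leftᵈ (pos P)) (rightᵈ (pos P))
  module U = Union (unionᵈ {σs = neg Q} {neg P}
    {F = λ η → backward E (++⁻ˡ (pos P) η)}
    (apply*ᵈ (pos Q ++ neg S) {map _* (neg Q)} (rightᵈ 𝐟-types ∘ᵈ forwardᵈ D ∘ᵈ leftᵈ (pos P)) cdᵈ)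
    (curried (backwardᵈ E $₂ leftᵈ (pos P) ∘ᵈ leftᵈ (pos P ++ neg S) , rightᵈ (pos P ++ neg S))))

-- Realizers do not depend on the point of the parameter space, so they serve unchanged and
-- quantification concerns `sound` alone. For the same reason the instance `f` in `∀-elim` may be
-- any Agda function, definable or not.
∀-intro : P ⟪ proj₂ ⟫ ⊢ Q → P ⊢ ∀ˢ Q
∀-intro ⟨ D ⟩ = ⟨ record { Entails D hiding (sound)
                        ; sound = λ x a d h y → Entails.sound D (y , x) a d h } ⟩

∀-elim : (f : X → Y) → P ⊢ ∀ˢ Q → P ⊢ Q ⟪ (λ x → f x , x) ⟫
∀-elim f ⟨ D ⟩ = ⟨ record { Entails D hiding (sound)
                         ; sound = λ x a d h → Entails.sound D x a d h (f x) } ⟩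

∃-mono : P ⊢ Q → ∃ˢ P ⊢ ∃ˢ Q
∃-mono {P = P} {Q} D = ⟨ record
  { forward   = forward D
  -- A single set is proposed: the element y may depend on the proposed set, so several sets might
  -- not yield one y that serves for all members of `d`.
  ; backward  = λ a d → sing* (U.union (++⁺ a d))
  ; forwardᵈ  = forwardᵈ D
  ; backwardᵈ = curried (sing*ᵈ (U.definable ∘ᵈ appendᵈ (leftᵈ (pos P)) (rightᵈ (pos P))))
  ; sound     = λ x a d h → let (y , r) = h (∈*-sing (U.union (++⁺ a d))) in
      y , λ {b} p → sound D (y , x) a b λ q → r (U.∈-union (++⁺ a d)
        (subst (b ∈*_) (sym (++⁻ʳ-++⁺ a d)) p)
        (subst (λ a → _ ∈* backward D a b) (sym (++⁻ˡ-++⁺ a d)) q))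
  } ⟩
  where
  module U = Union (unionᵈ {σs = neg Q} {neg P} {F = λ η → backward D (++⁻ˡ (pos P) η)}
    (rightᵈ (pos P))
    (curried (backwardᵈ D $₂ leftᵈ (pos P) ∘ᵈ leftᵈ (pos P ++ map _* (neg Q))
                           , rightᵈ (pos P ++ map _* (neg Q)))))

⊤-intro : P ⊢ ⊤ˢ
⊤-intro {P = P} = ⟨ record
  { forward   = λ _ → []
  ; backward  = λ _ _ → sing* (eval* (default* (neg P)) [])
  ; forwardᵈ  = by [] λ _ → refl
  ; backwardᵈ = curried (sing*ᵈ (constᵈ (default* (neg P))))
  ; sound     = λ _ _ _ _ → tt
  } ⟩

∧-mono : P ⊢ P′ → Q ⊢ Q′ → P ∧ˢ Q ⊢ P′ ∧ˢ Q′
∧-mono D E = ∧-intro (fst ⨾ D) (snd ⨾ E)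

⇒-mono : P′ ⊢ P → Q ⊢ Q′ → P ⇒ˢ Q ⊢ P′ ⇒ˢ Q′
⇒-mono D E = ⇒-intro (⇒-elim fst (snd ⨾ D) ⨾ E)

∀-mono : P ⊢ Q → ∀ˢ P ⊢ ∀ˢ Q
∀-mono ⟨ D ⟩ = ⟨ record { Entails D hiding (sound)
                       ; sound = λ x a d h y → Entails.sound D (y , x) a d λ p → h p y } ⟩

-- The predicates 𝓘 as problems, with induction and case distinction

⟦𝓘⟧ : (p : Plain σ) → ∣ σ ∣ → Env (CP.pos p) → Env (CP.neg p) → Set

𝐈 : Plain σ → (X → ∣ σ ∣) → Problem X
pos (𝐈 p h)        = CP.pos p
neg (𝐈 p h)        = CP.neg p
realized (𝐈 p h) x = ⟦𝓘⟧ p (h x)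

⟦𝓘⟧ nat     m (n ∷ []) [] = m ≡ n
⟦𝓘⟧ bool    i (j ∷ []) [] = i ≡ j
⟦𝓘⟧ (p ⇒ q) = realized (∀ˢ (𝐈 p proj₁ ⇒ˢ 𝐈 q (λ (x , h) → h ⟨$⟩ x)))

ℕ-witness : ∀ {h : X → ℕ} {x ks} c → realized (𝐈 nat h) x ks c → ks ≡ h x ∷ []
ℕ-witness {ks = k ∷ []} [] refl = refl

ℕ-realized : ∀ {h : X → ℕ} {x} c → realized (𝐈 nat h) x (h x ∷ []) c
ℕ-realized [] = refl

-- The witness of A(n) is computed by recursion on n.  The set of those
-- negative witnesses of H on which A(n) at b depends is accumulated, also by
-- recursion on n, as a function of b.
ℕ-induction : {H : Problem X} {A : Problem (ℕ × X)} →
              H ⊢ A ⟪ (λ x → 0 , x) ⟫ →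
              (H ⟪ proj₂ ⟫ ∧ˢ 𝐈 nat proj₁) ∧ˢ A ⊢ A ⟪ (λ (n , x) → suc n , x) ⟫ →
              H ⟪ proj₂ ⟫ ∧ˢ 𝐈 nat proj₁ ⊢ A
ℕ-induction {X} {H} {A} D E = ⟨ record
  { forward   = a.function
  ; backward  = λ η b → join {σs = neg H} (apply* (neg A) {Hs} (W.function η) b) []
  ; forwardᵈ  = a.definable
  ; backwardᵈ = curried (joinᵈ {σs = neg H}
      (apply*ᵈ (neg A) {Hs} (W.definable ∘ᵈ leftᵈ hn⁺) (rightᵈ hn⁺)) (by [] λ _ → refl))
  ; sound     = λ (n , x) η b r →
      -- The premise is available only at members of the set given by `backward`. That set is
      -- inhabited, and at any member the second conjunct identifies the witness for 𝓘_ℕ with `n`.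
      let η≡ : ++⁻ʳ (pos H) η ≡ n ∷ []
          η≡ = let (c , p) = ∈*-inhabited (join {σs = neg H} (apply* (neg A) {Hs} (W.function η) b) [])
               in ℕ-witness {h = proj₁} {n , x} (++⁻ʳ (neg H) c) (proj₂ (r p))
          hn≡ : ++⁺ (++⁻ˡ (pos H) η) (n ∷ []) ≡ η
          hn≡ = trans (cong (++⁺ _) (sym η≡)) (++⁺-++⁻ (pos H) η)
      in subst (λ η → realized A (n , x) (a.function η) b) hn≡
           (sound-at x (++⁻ˡ (pos H) η) n b λ {c} p →
             subst (realized H x _) (++⁻ˡ-++⁺ c [])
               (proj₁ (r (∈*-join {σs = neg H} {ys = []}
                 (subst (λ η → c ∈* apply* (neg A) {Hs} (W.function η) b) hn≡ p) tt))))
  } ⟩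
  where
  Hs hn⁺ hnW : List Ty
  Hs  = map _* (neg H)
  hn⁺ = pos H ++ nat ∷ []
  hnW = hn⁺ ++ map (neg A ⇒*_) Hs
  module a = Recursion (recursion (forwardᵈ D) (forwardᵈ E))
  module W₀ = Abstraction (abstraction {τs = Hs} (backwardᵈ D))
  G : Env hn⁺ → Env (neg A) → Env (map _* ((neg H ++ []) ++ neg A))
  G η = backward E (++⁺ η (a.function η))
  Gᵈ : Definable {hnW ++ neg A} (λ ζ → G (++⁻ˡ hn⁺ (++⁻ˡ hnW ζ)) (++⁻ʳ hnW ζ))
  Gᵈ = backwardᵈ E $₂ appendᵈ ηᵈ (a.definable ∘ᵈ ηᵈ) , rightᵈ hnW
    where
    ηᵈ : Definable {hnW ++ neg A} (λ ζ → ++⁻ˡ hn⁺ (++⁻ˡ hnW ζ))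
    ηᵈ = leftᵈ hn⁺ ∘ᵈ leftᵈ hnW
  module U = Union (unionᵈ {σs = neg A} {neg H} {F = λ ζ → apply* (neg A) {Hs} (++⁻ʳ hn⁺ (++⁻ˡ hnW ζ))}
    (splitʳᵈ (neg H ++ []) Gᵈ)
    (curried (apply*ᵈ (neg A) {Hs} (rightᵈ hn⁺ ∘ᵈ leftᵈ hnW ∘ᵈ leftᵈ (hnW ++ neg A)) (rightᵈ (hnW ++ neg A)))))
  -- The set for n + 1 holds what the induction step asks of `H` directly, and what was collected at
  -- n for each negative witness of `A` that the step asks of the induction hypothesis. The latter
  -- witnesses may differ from `b`, which is why functions of b are accumulated.
  step : Env hnW → Env (neg A) → Env Hs
  step η b = _∪*_ {neg H} (splitˡ (neg H) (splitˡ (neg H ++ []) (G (++⁻ˡ hn⁺ η) b))) (U.union (++⁺ η b))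
  module S = Abstraction (abstraction {F = step} (curried (∪*ᵈ {τs = neg H}
    (splitˡᵈ (neg H) (splitˡᵈ (neg H ++ []) Gᵈ)) (U.definable ∘ᵈ appendᵈ (leftᵈ hnW) (rightᵈ hnW)))))
  module W = Recursion (recursion W₀.definable S.definable)
  sound-at : ∀ x h n b →
             (∀ {c} → c ∈* apply* (neg A) {Hs} (W.function (++⁺ h (n ∷ []))) b → realized H x h c) →
             realized A (n , x) (a.function (++⁺ h (n ∷ []))) b
  sound-at x h zero b r = subst (λ a → realized A (0 , x) a b) (sym (a.at-zero h))
    (sound D x h b λ {c} p → r (subst (c ∈*_)
      (sym (trans (cong (λ w → apply* (neg A) {Hs} w b) (W.at-zero h)) (W₀.β h b))) p))
  sound-at x h (suc n) b r = subst (λ a → realized A (suc n , x) a b) (sym (a.at-suc h n))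
    (sound E (n , x) (++⁺ hn (a.function hn)) b λ {c} p →
      ∧-realized {P = H ⟪ proj₂ ⟫ ∧ˢ 𝐈 nat proj₁} {A}
        (∧-realized {P = H ⟪ proj₂ ⟫} {𝐈 nat proj₁}
          (r (toW (∈*-∪ˡ {neg H} (∈*-splitˡ (neg H) (∈*-splitˡ (neg H ++ [])
            (subst (λ η → c ∈* G η b) (sym (++⁻ˡ-++⁺ hn w)) p))))))
          (ℕ-realized {h = proj₁} {n , x} (++⁻ʳ (neg H) _)))
        (sound-at x h n _ λ {c′} q → r (toW (∈*-∪ʳ {neg H} (U.∈-union ζ
          (∈*-splitʳ (neg H ++ []) (subst₂ (λ η b → c ∈* G η b)
            (sym (trans (cong (++⁻ˡ hn⁺) ζˡ) (++⁻ˡ-++⁺ hn w))) (sym (++⁻ʳ-++⁺ (++⁺ hn w) b)) p))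
          (subst (λ w → c′ ∈* apply* (neg A) {Hs} w _)
            (sym (trans (cong (++⁻ʳ hn⁺) ζˡ) (++⁻ʳ-++⁺ hn w))) q))))))
    where
    hn : Env hn⁺
    hn = ++⁺ h (n ∷ [])
    w : Env (map (neg A ⇒*_) Hs)
    w = W.function hn
    ζ : Env (hnW ++ neg A)
    ζ = ++⁺ (++⁺ hn w) b
    ζˡ : ++⁻ˡ hnW ζ ≡ ++⁺ hn w
    ζˡ = ++⁻ˡ-++⁺ (++⁺ hn w) b
    toW : ∀ {c} → c ∈* step (++⁺ hn w) b → c ∈* apply* (neg A) {Hs} (W.function (++⁺ h (suc n ∷ []))) b
    toW {c} = subst (c ∈*_)
      (sym (trans (cong (λ w → apply* (neg A) {Hs} w b) (W.at-suc h n)) (S.β (++⁺ hn w) b)))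

𝔹-witness : ∀ {h : X → Bool} {x is} c → realized (𝐈 bool h) x is c → is ≡ h x ∷ []
𝔹-witness {is = i ∷ []} [] refl = refl

𝔹-cases : {H : Problem X} {A : Problem (Bool × X)} →
          H ⊢ A ⟪ (λ x → false , x) ⟫ → H ⊢ A ⟪ (λ x → true , x) ⟫ →
          H ⟪ proj₂ ⟫ ∧ˢ 𝐈 bool proj₁ ⊢ A
𝔹-cases {X} {H} {A} D E = ⟨ record
  { forward   = f
  ; backward  = λ η b → join {σs = neg H} (G η b) []
  ; forwardᵈ  = caseᵈ (forwardᵈ D) (forwardᵈ E)
  ; backwardᵈ = curried (joinᵈ {σs = neg H} (∪*ᵈ {τs = neg H}
      (backwardᵈ D $₂ leftᵈ (pos H) ∘ᵈ leftᵈ hi⁺ , rightᵈ hi⁺)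
      (backwardᵈ E $₂ leftᵈ (pos H) ∘ᵈ leftᵈ hi⁺ , rightᵈ hi⁺)) (by [] λ _ → refl))
  ; sound     = λ (i , x) η b r →
      let (c , p) = ∈*-inhabited (join {σs = neg H} (G η b) [])
      in sound-at i x η b (𝔹-witness {h = proj₁} {i , x} (++⁻ʳ (neg H) c) (proj₂ (r p))) λ {c} q →
           subst (realized H x _) (++⁻ˡ-++⁺ c [])
             (proj₁ (r (∈*-join {σs = neg H} {ys = []} q tt)))
  } ⟩
  where
  hi⁺ : List Ty
  hi⁺ = pos H ++ bool ∷ []
  f : Env hi⁺ → Env (pos A)
  f η = if All.head (++⁻ʳ (pos H) η) then forward E (++⁻ˡ (pos H) η) else forward D (++⁻ˡ (pos H) η)
  G : Env hi⁺ → Env (neg A) → Env (map _* (neg H))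
  -- Both branches contribute, whatever the Boolean is; the branch not taken merely enlarges what is
  -- asked of `H`.
  G η b = _∪*_ {neg H} (backward D (++⁻ˡ (pos H) η) b) (backward E (++⁻ˡ (pos H) η) b)
  sound-at : ∀ i x η b → ++⁻ʳ (pos H) η ≡ i ∷ [] →
             (∀ {c} → c ∈* G η b → realized H x (++⁻ˡ (pos H) η) c) → realized A (i , x) (f η) b
  sound-at i x η b eq r with ++⁻ʳ (pos H) η
  sound-at false x η b refl r | _ = sound D x _ b λ p → r (∈*-∪ˡ {neg H} p)
  sound-at true  x η b refl r | _ = sound E x _ b λ p → r (∈*-∪ʳ {neg H} p)

-- The constants of HA^ω

Plain-irrelevant : (p q : Plain σ) → p ≡ q
Plain-irrelevant nat     nat       = refl
Plain-irrelevant bool    bool      = refl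
Plain-irrelevant (p ⇒ q) (p′ ⇒ q′) = cong₂ _⇒_ (Plain-irrelevant p p′) (Plain-irrelevant q q′)

-- Different proofs of `Plain σ` arise, for instance, from the two occurrences of σ in the type of
-- Π. Their problems are identified here, along with those of equal elements.
𝐈-≡ : {p q : Plain σ} {h k : X → ∣ σ ∣} → (∀ x → h x ≡ k x) → H ⊢ 𝐈 p h → H ⊢ 𝐈 q k
𝐈-≡ {p = p} {q} h≡k D with refl ← Plain-irrelevant p q =
  D ⨾ ⟨ weaken (λ x a b → subst (λ z → ⟦𝓘⟧ p z a b) (h≡k x)) ⟩

module _ {p : Plain σ} {q : Plain τ} {h : X → ∣ σ ⇒ τ ∣} where

  𝐈-intro : H ⟪ proj₂ ⟫ ∧ˢ 𝐈 p proj₁ ⊢ 𝐈 q (λ (y , x) → h x ⟨$⟩ y) → H ⊢ 𝐈 (p ⇒ q) h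
  𝐈-intro D = ∀-intro (⇒-intro D) ⨾ ⟨ same ⟩

  𝐈-elim : {k : X → ∣ σ ∣} → H ⊢ 𝐈 (p ⇒ q) h → H ⊢ 𝐈 p k → H ⊢ 𝐈 q (λ x → h x ⟨$⟩ k x)
  𝐈-elim {k = k} D E =
    ⇒-elim (∀-elim {Q = 𝐈 p proj₁ ⇒ˢ 𝐈 q (λ (y , x) → h x ⟨$⟩ y)} k (D ⨾ ⟨ same ⟩) ⨾ ⟨ same ⟩) E

weak : {p : Plain σ} {h : X → ∣ σ ∣} {u : Y → X} → H ⊢ 𝐈 p h → H ⟪ u ⟫ ∧ˢ Q ⊢ 𝐈 p (h ∘ u)
weak {u = u} D = fst ⨾ reindex u D ⨾ ⟨ same ⟩

∧-intro⟪⟫ : (u : Y → X) → H ⊢ P ⟪ u ⟫ → H ⊢ Q ⟪ u ⟫ → H ⊢ (P ∧ˢ Q) ⟪ u ⟫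
∧-intro⟪⟫ u D E = ∧-intro D E ⨾ ⟨ same ⟩

𝐈* : All Plain σs → (∀ {σ} → σ ∈ σs → X → ∣ σ ∣) → Problem X
𝐈* []       w = ⊤ˢ
𝐈* (p ∷ ps) w = 𝐈 p (w (here refl)) ∧ˢ 𝐈* ps (w ∘ there)

𝐈*-lookup : (ps : All Plain σs) {w : ∀ {σ} → σ ∈ σs → X → ∣ σ ∣} (u : Y → X) (i : σ ∈ σs) →
            𝐈* ps w ⟪ u ⟫ ⊢ 𝐈 (All.lookup ps i) (w i ∘ u)
𝐈*-lookup (p ∷ ps) u (here refl) = reindex u fst ⨾ ⟨ same ⟩
𝐈*-lookup (p ∷ ps) u (there i)   = reindex u snd ⨾ 𝐈*-lookup ps u i

𝐈*-tabulate : (ps : All Plain σs) {w : ∀ {σ} → σ ∈ σs → X → ∣ σ ∣} (u : Y → X) →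
              (∀ {σ} (i : σ ∈ σs) → H ⊢ 𝐈 (All.lookup ps i) (w i ∘ u)) → H ⊢ 𝐈* ps w ⟪ u ⟫
𝐈*-tabulate []       u D = ⊤-intro ⨾ ⟨ same ⟩
𝐈*-tabulate (p ∷ ps) u D = ∧-intro⟪⟫ u (D (here refl) ⨾ ⟨ same ⟩) (𝐈*-tabulate ps u (D ∘ there))

component : σ ∈ σs → Env σs × X → ∣ σ ∣
component i (w , _) = All.lookup w i

𝐈-intro* : (ps : All Plain σs) {p : Plain (σs ⇒* τ)} {q : Plain τ} {h : X → ∣ σs ⇒* τ ∣} →
           H ⟪ proj₂ ⟫ ∧ˢ 𝐈* ps component ⊢ 𝐈 q (λ (w , x) → apply σs τ (h x) w) →
           H ⊢ 𝐈 p h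
𝐈-intro* [] {q = q} D =
  ∧-intro⟪⟫ ([] ,_) ⟨ same ⟩ (⊤-intro ⨾ ⟨ same ⟩) ⨾ reindex ([] ,_) D ⨾ 𝐈-≡ {p = q} (λ _ → refl) ⟨ same ⟩
𝐈-intro* (r ∷ ps) {p ⇒ p′} {q} D = 𝐈-intro (𝐈-intro* ps {q = q} (
  -- The assumption on the first argument leaves the context and becomes the head of the tuple.
  ∧-intro⟪⟫ u (fst ⨾ reindex proj₂ fst ⨾ ⟨ same ⟩) (𝐈*-tabulate (r ∷ ps) {component} u λ
    { (here refl) → 𝐈-≡ {p = p} (λ _ → refl) (fst ⨾ reindex proj₂ snd ⨾ ⟨ same ⟩)
    ; (there i)   → snd ⨾ ⟨ same ⟩ ⨾ 𝐈*-lookup ps id i })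
  ⨾ reindex u D ⨾ ⟨ same ⟩))
  where
  u : Env _ × (_ × _) → Env (_ ∷ _) × _
  u (w , (y , x)) = y ∷ w , x

𝐈-elim* : (ps : All Plain σs) {p : Plain (σs ⇒* τ)} {q : Plain τ} {h : X → ∣ σs ⇒* τ ∣}
          {k : ∀ {σ} → σ ∈ σs → X → ∣ σ ∣} → H ⊢ 𝐈 p h →
          (∀ {σ} (i : σ ∈ σs) → H ⊢ 𝐈 (All.lookup ps i) (k i)) →
          H ⊢ 𝐈 q (λ x → apply σs τ (h x) (All.tabulate λ i → k i x))
𝐈-elim* []       {p}               D E = 𝐈-≡ {p = p} (λ _ → refl) D
𝐈-elim* (r ∷ ps) {p ⇒ p′} {k = k} D E =
  𝐈-elim* ps (𝐈-elim D (𝐈-≡ {p = r} {p} (λ _ → refl) (E (here refl)))) (E ∘ there)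

-- A cut at a single point of a family over `Y × X`. It instantiates a result proved for all n
-- satisfying 𝓘_ℕ at an n already assumed to do so.
∧-assume : {h : X → Y} → H ⊢ P ⟪ (λ x → h x , x) ⟫ → H ⟪ proj₂ ⟫ ∧ˢ P ⊢ Q →
           H ⊢ Q ⟪ (λ x → h x , x) ⟫
∧-assume {h = h} D E = ∧-intro⟪⟫ (λ x → h x , x) ⟨ same ⟩ D ⨾ reindex _ E

ℕ-suc : {h : X → ℕ} → 𝐈 nat h ⊢ 𝐈 nat (suc ∘ h)
ℕ-suc {h = h} = ⟨ record
  { forward   = λ { (n ∷ []) → suc n ∷ [] }
  ; backward  = λ _ _ → []
  ; forwardᵈ  = by (con (ha sucᶜ) · x₀ ∷ []) λ { (n ∷ []) → refl }
  ; backwardᵈ = curried (by [] λ _ → refl)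
  ; sound     = λ { x (n ∷ []) [] r → cong suc (r {[]} tt) }
  } ⟩

ground : ∀ {p : Plain σ} {h : X → ∣ σ ∣} (t : WTms [] (CP.pos p)) →
         (∀ x b → ⟦𝓘⟧ p (h x) (eval* t []) b) → H ⊢ 𝐈 p h
ground {H = H} {p} t r = ⟨ record
  { forward   = λ _ → eval* t []
  ; backward  = λ _ _ → sing* (eval* (default* (neg H)) [])
  ; forwardᵈ  = constᵈ t
  ; backwardᵈ = curried (sing*ᵈ (constᵈ (default* (neg H))))
  ; sound     = λ x _ b _ → r x b
  } ⟩

codomain : Plain (σ ⇒ τ) → Plain τ
codomain (p ⇒ q) = q

codomain* : ∀ σs → Plain (σs ⇒* τ) → Plain τ
codomain* []       p       = p
codomain* (_ ∷ σs) (_ ⇒ p) = codomain* σs p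

step-plain : All Plain σs → Plain τ → Plain (Step σs τ)
step-plain []       q = nat ⇒ q
step-plain (p ∷ ps) q = nat ⇒ p ⇒ codomain (step-plain ps q)

-- The induction formula is the conjunction over all components, because each component at n + 1
-- applies its step function to the whole tuple at n.
rec-realized : (ps : All Plain σs) (fs : All Plain (Steps σs))
               {w : X → Env σs} {f : X → Env (Steps σs)} →
               (∀ {σ} (i : σ ∈ σs) → H ⊢ 𝐈 (All.lookup ps i) (λ x → All.lookup (w x) i)) →
               (∀ {σ} (i : σ ∈ Steps σs) → H ⊢ 𝐈 (All.lookup fs i) (λ x → All.lookup (f x) i)) →
               H ⟪ proj₂ ⟫ ∧ˢ 𝐈 nat proj₁ ⊢
               𝐈* ps (λ i (n , x) → All.lookup (Recursor.rec σs n (w x) (f x)) i)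
rec-realized {σs} ps fs {w} {f} D E = ℕ-induction
  (𝐈*-tabulate ps _ D)
  (𝐈*-tabulate ps _ λ {σ} i → 𝐈-≡
    (λ (n , x) → trans
      (cong (apply σs σ (All.lookup (f x) (∈-map⁺ (Step σs) i) ⟨$⟩ n))
        (tabulate-lookup (Recursor.rec σs n (w x) (f x))))
      (sym (lookup-tabulate _ i)))
    (𝐈-elim* ps {q = All.lookup ps i}
      (𝐈-elim {h = λ (n , x) → All.lookup (f x) (∈-map⁺ (Step σs) i)}
        (fst ⨾ weak (𝐈-≡ {q = nat ⇒ codomain (All.lookup fs (∈-map⁺ (Step σs) i))} (λ _ → refl)
          (E (∈-map⁺ (Step σs) i))))
        (fst ⨾ snd))
      (λ j → snd ⨾ ⟨ same ⟩ ⨾ 𝐈*-lookup ps id j)))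

constant-realized : (c : HACon Plain σ) (p : Plain σ) → H ⊢ 𝐈 p (λ _ → ⟦ embed c ⟧ᴴ)
constant-realized (Πᶜ _ _) (p ⇒ q ⇒ p′) =
  𝐈-intro (𝐈-intro (weak (𝐈-≡ {p = p} (λ _ → refl) snd)))
constant-realized (Σᶜ _ _ _) ((p ⇒ q ⇒ r) ⇒ (p′ ⇒ q′) ⇒ p″ ⇒ r′) =
  𝐈-intro (𝐈-intro (𝐈-intro (𝐈-≡ {p = r} (λ _ → refl)
    (𝐈-elim (𝐈-elim (weak (weak snd)) (𝐈-≡ {p = p″} (λ _ → refl) snd))
            (𝐈-≡ {p = q′} (λ _ → refl) (𝐈-elim (weak snd) (𝐈-≡ {p = p″} (λ _ → refl) snd)))))))
constant-realized zeroᶜ nat = ground {p = nat} (con (ha zeroᶜ) ∷ []) λ { _ [] → refl }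
constant-realized sucᶜ (nat ⇒ nat) = 𝐈-intro (snd ⨾ ℕ-suc ⨾ ⟨ same ⟩)
constant-realized 0ᴮ bool = ground {p = bool} (con (ha 0ᴮ) ∷ []) λ { _ [] → refl }
constant-realized 1ᴮ bool = ground {p = bool} (con (ha 1ᴮ) ∷ []) λ { _ [] → refl }
constant-realized (condᶜ r) (bool ⇒ p ⇒ p′ ⇒ p″) = 𝐈-intro (𝔹-cases
  (𝐈-intro {p = p} {h = λ _ → cond ⟨$⟩ false}
    (𝐈-intro {p = p′} (weak (𝐈-≡ {p = p} {p″} (λ _ → refl) snd))) ⨾ ⟨ same ⟩)
  (𝐈-intro {p = p} {h = λ _ → cond ⟨$⟩ true}
    (𝐈-intro {p = p′} {p″} (𝐈-≡ {p = p′} (λ _ → refl) snd)) ⨾ ⟨ same ⟩))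
  where
  cond = ⟦ embed (condᶜ r) ⟧ᴴ
constant-realized (recᶜ {σs} {σ} ps i) (nat ⇒ p) = 𝐈-intro
  (𝐈-intro* ps {q = codomain* σs p} (𝐈-intro* fs {q = All.lookup ps i}
    (∧-assume (fst ⨾ reindex proj₂ (fst ⨾ reindex proj₂ snd) ⨾ ⟨ same ⟩)
      (rec-realized ps fs {λ (_ , (w , _)) → w} {λ (f , _) → f}
        (λ j → fst ⨾ reindex proj₂ snd ⨾ 𝐈*-lookup ps proj₂ j)
        (λ j → snd ⨾ ⟨ same ⟩ ⨾ 𝐈*-lookup fs id j)) ⨾
     𝐈-≡ (λ (f , (w , (n , _))) → sym (eval-rec i n w f)) (𝐈*-lookup ps _ i))))
  where
  fs : All Plain (Steps σs)
  fs = All-map⁺ (All.map (step-plain ps) ps)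

open UInterpretation 𝓘ᶜᵖ renaming (⟨_⟩ to ⟨_⟩ᵁ)

-- The interpretation of formulas in the model

Π-⇔ : ∀ {A : Set} {B C : A → Set} → (∀ x → B x ⇔ C x) → (∀ x → B x) ⇔ (∀ x → C x)
Π-⇔ e = mk⇔ (λ f x → Equivalence.to (e x) (f x)) (λ f x → Equivalence.from (e x) (f x))

→-⇔ : ∀ {A B C D : Set} → A ⇔ B → C ⇔ D → (A → C) ⇔ (B → D)
→-⇔ d e = mk⇔ (λ f b → Equivalence.to e (f (Equivalence.from d b)))
              (λ f a → Equivalence.from e (f (Equivalence.to d a)))

Σ-⇔ : ∀ {A : Set} {B C : A → Set} → (∀ x → B x ⇔ C x) → (Σ[ x ∈ A ] B x) ⇔ (Σ[ x ∈ A ] C x)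
Σ-⇔ e = mk⇔ (λ (x , b) → x , Equivalence.to (e x) b) (λ (x , c) → x , Equivalence.from (e x) c)

×-⇔ : ∀ {A B C D : Set} → A ⇔ B → C ⇔ D → (A × C) ⇔ (B × D)
×-⇔ d e = mk⇔ (λ (a , c) → Equivalence.to d a , Equivalence.to e c)
              (λ (b , d′) → Equivalence.from d b , Equivalence.from e d′)

≡-⇔ : ∀ {A B : Set} → A ≡ B → A ⇔ B
≡-⇔ refl = ⇔-id _

∈-Π-⇔ : ∀ {A : Set} {R R′ B C : A → Set} → (∀ x → R x ⇔ R′ x) → (∀ x → B x ⇔ C x) →
        (∀ {x} → R x → B x) ⇔ (∀ {x} → R′ x → C x)
∈-Π-⇔ d e = mk⇔ (λ f {x} r → Equivalence.to (e x) (f (Equivalence.from (d x) r)))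
                (λ f {x} r → Equivalence.from (e x) (f (Equivalence.to (d x) r)))

-- Keeping `ζ` a variable constrained by an equation lets the induction pass under a binder by
-- merely extending that equation.
Holds-⟦⟧ : ∀ (A : Fm Target Γ) (ρ : WTms Δ Γ) {η ζ} → eval* ρ η ≡ ζ → Holds (A ⟦ ρ ⟧) η ⇔ Holds A ζ
Holds-⟦⟧ ⊥′       ρ e = ⇔-id _
Holds-⟦⟧ (A ∧′ B) ρ e = ×-⇔ (Holds-⟦⟧ A ρ e) (Holds-⟦⟧ B ρ e)
Holds-⟦⟧ (A ⇒′ B) ρ e = →-⇔ (Holds-⟦⟧ A ρ e) (Holds-⟦⟧ B ρ e)
Holds-⟦⟧ (∀′ {σ} _ A) ρ {η} e = Π-⇔ λ x →
  Holds-⟦⟧ A (lift (σ ∷ []) ρ) (trans (eval*-lift (σ ∷ []) ρ (x ∷ []) η) (cong (x ∷_) e))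
Holds-⟦⟧ (∃′ {σ} _ A) ρ {η} e = Σ-⇔ λ x →
  Holds-⟦⟧ A (lift (σ ∷ []) ρ) (trans (eval*-lift (σ ∷ []) ρ (x ∷ []) η) (cong (x ∷_) e))
Holds-⟦⟧ (_≈′_ {σ} s t) ρ {η} refl = ≡-⇔ (cong₂ (Setoid._≈_ ⟦ σ ⟧ᵀ) (eval-[] s ρ η) (eval-[] t ρ η))
Holds-⟦⟧ (rel (mem {σ}) (s ∷ t ∷ [])) ρ {η} refl = ≡-⇔ (cong₂ (In σ) (eval-[] s ρ η) (eval-[] t ρ η))

Holds-∀* : ∀ τs (A : Fm Target (τs ++ Γ)) {η} → (∀ b → Holds A (++⁺ b η)) → Holds (∀* τs A) η
Holds-∀* []       A h = h []
Holds-∀* (τ ∷ τs) A h = Holds-∀* τs (∀′ _ A) λ b x → h (x ∷ b)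

Holds-∀∈ : ∀ τs (Bs : WTms Γ (map _* τs)) (A : Fm Target (τs ++ Γ)) {η} →
           Holds (∀∈ τs Bs A) η ⇔ (∀ {b} → b ∈* eval* Bs η → Holds A (++⁺ b η))
Holds-∀∈ []       []       A = mk⇔ (λ { h {[]} _ → h }) (λ h → h {[]} tt)
Holds-∀∈ (τ ∷ τs) (B ∷ Bs) A {η} = mk⇔
    (λ { h {x ∷ b} (p , q) → Equivalence.to IH h {b} q x (subst (In τ x) (sym (B≡ x b)) p) })
    (λ h → Equivalence.from IH λ {b} q x p → h {x ∷ b} (subst (In τ x) (B≡ x b) p , q))
  where
  IH = Holds-∀∈ τs Bs (∀′ _ (rel mem (x₀ ∷ B [ wk (τ ∷ τs) ] ∷ []) ⇒′ A)) {η}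
  B≡ : ∀ x b → eval (B [ wk (τ ∷ τs) ]) (x ∷ ++⁺ b η) ≡ eval B η
  B≡ x b = trans (eval-[] B (wk (τ ∷ τs)) _) (cong (eval B) (eval*-wk (τ ∷ τs) (x ∷ b) η))

module _ (σs⁺ σs⁻ τs⁺ τs⁻ : List Ty) where
  private module A = Arrow σs⁺ σs⁻ τs⁺ τs⁻

  eval*-𝐟𝐚 : ∀ {fg : WTms Γ A.pos} {ad : WTms Γ A.neg} {η FG AD} → eval* fg η ≡ FG → eval* ad η ≡ AD →
    eval* (A.Parts.𝐟𝐚 fg ad) η ≡ apply* σs⁺ {τs⁺} (++⁻ˡ A.𝐟-types FG) (++⁻ˡ σs⁺ AD)
  eval*-𝐟𝐚 {fg = fg} {ad} refl refl = trans (eval*-·· {τs = τs⁺} (++⁻ˡ A.𝐟-types fg) (++⁻ˡ σs⁺ ad) _)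
    (cong₂ (apply* σs⁺ {τs⁺}) (map-++⁻ˡ _ A.𝐟-types fg) (map-++⁻ˡ _ σs⁺ ad))

  eval*-𝐠𝐚𝐝 : ∀ {fg : WTms Γ A.pos} {ad : WTms Γ A.neg} {η FG AD} → eval* fg η ≡ FG → eval* ad η ≡ AD →
    eval* (A.Parts.𝐠𝐚𝐝 fg ad) η ≡ apply* A.neg {map _* σs⁻} (++⁻ʳ A.𝐟-types FG) AD
  eval*-𝐠𝐚𝐝 {fg = fg} {ad} refl refl = trans (eval*-·· {τs = map _* σs⁻} (++⁻ʳ A.𝐟-types fg) ad _)
    (cong (λ gs → apply* A.neg {map _* σs⁻} gs _) (map-++⁻ʳ _ A.𝐟-types fg))

-- The clause of `CP.relation` for `p ⇒ q` contains substitution instances of the relations for `p`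
-- and `q`, so the recursion on types passes through the substituted form.
⟨𝓘⟩-⟦𝓘⟧ : ∀ (p : Plain σ) (ρ : WTms Γ (σ ∷ CP.pos p ++ CP.neg p)) {η x a b} →
          eval* ρ η ≡ x ∷ ++⁺ a b → Holds (CP.relation p ⟦ ρ ⟧) η ⇔ ⟦𝓘⟧ p x a b
relation-⟦𝓘⟧ : ∀ (p : Plain σ) x a b → Holds (CP.relation p) (x ∷ ++⁺ a b) ⇔ ⟦𝓘⟧ p x a b

⟨𝓘⟩-⟦𝓘⟧ p ρ e = relation-⟦𝓘⟧ p _ _ _ ⇔-∘ Holds-⟦⟧ (CP.relation p) ρ e
relation-⟦𝓘⟧ nat  m (n ∷ []) [] = ⇔-id _
relation-⟦𝓘⟧ bool i (j ∷ []) [] = ⇔-id _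
relation-⟦𝓘⟧ {σ ⇒ τ} (p ⇒ q) h fg ad = Π-⇔ λ x → →-⇔
  (∈-Π-⇔ (λ b → ≡-⇔ (cong (b ∈*_) (eval*-𝐠𝐚𝐝 (CP.pos p) (CP.neg p) (CP.pos q) (CP.neg q) (fg≡ x) (ad≡ x))))
         (λ b → ⟨𝓘⟩-⟦𝓘⟧ p _ (cong₂ _∷_
           (trans (eval-[] x₀ (wk (CP.neg p)) _) (cong (eval x₀) (eval*-wk (CP.neg p) b (ζ x))))
           (trans (map-++⁺ _ (𝐚 [ wk (CP.neg p) ]*) (locals (CP.neg p)))
             (cong₂ ++⁺ (trans (eval*-[wk] (CP.neg p) 𝐚 b (ζ x)) (𝐚≡ x)) (eval*-locals (CP.neg p) b (ζ x))))))
   ⇔-∘ Holds-∀∈ (CP.neg p) _ _)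
  (⟨𝓘⟩-⟦𝓘⟧ q _ (cong (_ ∷_) (trans (map-++⁺ _ 𝐟𝐚 𝐝)
    (cong₂ ++⁺ (eval*-𝐟𝐚 (CP.pos p) (CP.neg p) (CP.pos q) (CP.neg q) (fg≡ x) (ad≡ x)) (𝐝≡ x)))))
  where
  p⇒q⁺ : List Ty
  p⇒q⁺ = CP.pos (p ⇒ q)
  ζ : ∣ σ ∣ → Env (σ ∷ (σ ⇒ τ) ∷ p⇒q⁺ ++ CP.neg (p ⇒ q))
  ζ x = x ∷ h ∷ ++⁺ fg ad
  fgad : WTms (σ ∷ (σ ⇒ τ) ∷ p⇒q⁺ ++ CP.neg (p ⇒ q)) (p⇒q⁺ ++ CP.neg (p ⇒ q))
  fgad = wk (σ ∷ (σ ⇒ τ) ∷ [])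
  open Arrow.Parts (CP.pos p) (CP.neg p) (CP.pos q) (CP.neg q) (++⁻ˡ p⇒q⁺ fgad) (++⁻ʳ p⇒q⁺ fgad)
  fgad≡ : ∀ x → eval* fgad (ζ x) ≡ ++⁺ fg ad
  fgad≡ x = eval*-wk (σ ∷ (σ ⇒ τ) ∷ []) (x ∷ h ∷ []) (++⁺ fg ad)
  fg≡ : ∀ x → eval* (++⁻ˡ p⇒q⁺ fgad) (ζ x) ≡ fg
  fg≡ x = trans (map-++⁻ˡ _ p⇒q⁺ fgad) (trans (cong (++⁻ˡ p⇒q⁺) (fgad≡ x)) (++⁻ˡ-++⁺ fg ad))
  ad≡ : ∀ x → eval* (++⁻ʳ p⇒q⁺ fgad) (ζ x) ≡ ad
  ad≡ x = trans (map-++⁻ʳ _ p⇒q⁺ fgad) (trans (cong (++⁻ʳ p⇒q⁺) (fgad≡ x)) (++⁻ʳ-++⁺ fg ad))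
  𝐚≡ : ∀ x → eval* 𝐚 (ζ x) ≡ ++⁻ˡ (CP.pos p) ad
  𝐚≡ x = trans (map-++⁻ˡ _ (CP.pos p) (++⁻ʳ p⇒q⁺ fgad)) (cong (++⁻ˡ (CP.pos p)) (ad≡ x))
  𝐝≡ : ∀ x → eval* 𝐝 (ζ x) ≡ ++⁻ʳ (CP.pos p) ad
  𝐝≡ x = trans (map-++⁻ʳ _ (CP.pos p) (++⁻ʳ p⇒q⁺ fgad)) (cong (++⁻ʳ (CP.pos p)) (ad≡ x))

⟦_⟧ᶠ : (A : Fm HA𝓘 Γ) → Env Γ → Env (A ⁺) → Env (A ⁻) → Set

sem : Fm HA𝓘 Γ → Problem (Env Γ)
pos (sem A)      = A ⁺
neg (sem A)      = A ⁻
realized (sem A) = ⟦ A ⟧ᶠ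

⟦ ⊥′ ⟧ᶠ _ _ _ = ⊥
⟦ A ∧′ B ⟧ᶠ = realized (sem A ∧ˢ sem B)
⟦ A ⇒′ B ⟧ᶠ = realized (sem A ⇒ˢ sem B)
⟦ ∀′ _ A ⟧ᶠ = realized (∀ˢ (sem A ⟪ uncurry _∷_ ⟫))
⟦ ∃′ _ A ⟧ᶠ = realized (∃ˢ (sem A ⟪ uncurry _∷_ ⟫))
⟦ _≈′_ {σ} s t ⟧ᶠ η _ _ = Setoid._≈_ ⟦ σ ⟧ᵀ (eval (toTarget s) η) (eval (toTarget t) η)
⟦ rel (𝓘 p) (t ∷ []) ⟧ᶠ η = ⟦𝓘⟧ p (eval (toTarget t) η)

-- This links the syntactic interpretation with problems. Its clauses split and weaken the terms,
-- whose values then match the expected tuples only up to `_≡_`; hence the three equations.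
Holds-⟨⟩ : ∀ (A : Fm HA𝓘 Γ) (x : WTms Δ Γ) (a : WTms Δ (A ⁺)) (b : WTms Δ (A ⁻)) {η X a′ b′} →
           eval* x η ≡ X → eval* a η ≡ a′ → eval* b η ≡ b′ →
           Holds (⟨ A ⟩ᵁ x a b) η ⇔ ⟦ A ⟧ᶠ X a′ b′
Holds-⟨⟩ ⊥′ x a b ex ea eb = ⇔-id _
Holds-⟨⟩ (A ∧′ B) x a b ex ea eb = ×-⇔
  (Holds-⟨⟩ A x _ _ ex (trans (map-++⁻ˡ _ (A ⁺) a) (cong (++⁻ˡ (A ⁺)) ea))
                       (trans (map-++⁻ˡ _ (A ⁻) b) (cong (++⁻ˡ (A ⁻)) eb)))
  (Holds-⟨⟩ B x _ _ ex (trans (map-++⁻ʳ _ (A ⁺) a) (cong (++⁻ʳ (A ⁺)) ea))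
                       (trans (map-++⁻ʳ _ (A ⁻) b) (cong (++⁻ʳ (A ⁻)) eb)))
Holds-⟨⟩ (A ⇒′ B) x fg ad {η} ex ef ed = →-⇔
  (∈-Π-⇔ (λ b → ≡-⇔ (cong (b ∈*_) (eval*-𝐠𝐚𝐝 (A ⁺) (A ⁻) (B ⁺) (B ⁻) ef ed)))
         (λ b → Holds-⟨⟩ A _ _ _
           (trans (eval*-[wk] (A ⁻) x b η) ex)
           (trans (eval*-[wk] (A ⁻) (++⁻ˡ (A ⁺) ad) b η) (trans (map-++⁻ˡ _ (A ⁺) ad) (cong (++⁻ˡ (A ⁺)) ed)))
           (eval*-locals (A ⁻) b η))
   ⇔-∘ Holds-∀∈ (A ⁻) _ _)
  (Holds-⟨⟩ B x _ _ ex (eval*-𝐟𝐚 (A ⁺) (A ⁻) (B ⁺) (B ⁻) ef ed)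
    (trans (map-++⁻ʳ _ (A ⁺) ad) (cong (++⁻ʳ (A ⁺)) ed)))
Holds-⟨⟩ (∀′ {σ} _ A) x a b {η} ex ea eb = Π-⇔ λ y → Holds-⟨⟩ A _ _ _
  (trans (eval*-lift (σ ∷ []) x (y ∷ []) η) (cong (y ∷_) ex))
  (trans (eval*-[wk] (σ ∷ []) a (y ∷ []) η) ea)
  (trans (eval*-[wk] (σ ∷ []) b (y ∷ []) η) eb)
Holds-⟨⟩ (∃′ {σ} _ A) x a B {η} ex ea eB = Σ-⇔ λ y →
  ∈-Π-⇔ (λ b → ≡-⇔ (cong (b ∈*_) (trans (eval*-[wk] (σ ∷ []) B (y ∷ []) η) eB)))
        (λ b → Holds-⟨⟩ A _ _ _
          (trans (eval*-[wk] (A ⁻) (lift (σ ∷ []) x) b (y ∷ η))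
            (trans (eval*-lift (σ ∷ []) x (y ∷ []) η) (cong (y ∷_) ex)))
          (trans (eval*-[wk] (A ⁻) (a [ wk (σ ∷ []) ]*) b (y ∷ η))
            (trans (eval*-[wk] (σ ∷ []) a (y ∷ []) η) ea))
          (eval*-locals (A ⁻) b (y ∷ η)))
  ⇔-∘ Holds-∀∈ (A ⁻) _ _
Holds-⟨⟩ (_≈′_ {σ} s t) x _ _ {η} refl _ _ =
  ≡-⇔ (cong₂ (Setoid._≈_ ⟦ σ ⟧ᵀ) (eval-[] (toTarget s) x η) (eval-[] (toTarget t) x η))
Holds-⟨⟩ (rel (𝓘 p) (t ∷ [])) x a b {η} refl refl refl =
  ⟨𝓘⟩-⟦𝓘⟧ p _ (cong₂ _∷_ (eval-[] (toTarget t) x η) (map-++⁺ _ a b))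

-- The problem `⊤ˢ` has the empty tuple of positive witnesses, so the terms that define `forward`
-- are closed, as the definition of interpretability demands.
interpretable : (A : Fm HA𝓘 Γ) → ⊤ˢ ⊢ sem A → UInterpretable A
interpretable A D = t , λ η → Holds-∀* (A ⁻) _ λ b → Equivalence.from
  (Holds-⟨⟩ A _ _ _ (eval*-wk (A ⁻) b η)
    (trans (eval*-[] t [] _) (correct (forwardᵈ D) [])) (eval*-locals (A ⁻) b η))
  (sound D η [] b λ _ → tt)
  where
  t : WTms [] (A ⁺)
  t = terms (forwardᵈ D)

-- The axioms of HA^ω

⟪⟫-≡ : {u v : Y → X} → (∀ y → u y ≡ v y) → P ⟪ u ⟫ ⊢ P ⟪ v ⟫
⟪⟫-≡ {P = P} u≡v = ⟨ weaken (λ y a b → subst (λ x → realized P x a b) (u≡v y)) ⟩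

sem-⇒-intro : {A B : Fm HA𝓘 Γ} → H ∧ˢ sem A ⊢ sem B → H ⊢ sem (A ⇒′ B)
sem-⇒-intro D = ⇒-intro D ⨾ ⟨ same ⟩

sem-⇒-elim : {A B : Fm HA𝓘 Γ} {u : X → Env Γ} →
             H ⊢ sem (A ⇒′ B) ⟪ u ⟫ → H ⊢ sem A ⟪ u ⟫ → H ⊢ sem B ⟪ u ⟫
sem-⇒-elim {A = A} {B} {u} D E = ⇒-elim {Q = sem A ⟪ u ⟫} {sem B ⟪ u ⟫} (D ⨾ ⟨ same ⟩) E

sem-fst : {A B : Fm HA𝓘 Γ} → sem (A ∧′ B) ⊢ sem A
sem-fst {A = A} {B} = ⟨ same ⟩ ⨾ fst {Q = sem B}

sem-snd : {A B : Fm HA𝓘 Γ} → sem (A ∧′ B) ⊢ sem B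
sem-snd {A = A} {B} = ⟨ same ⟩ ⨾ snd {P = sem A}

∀𝓘-intro : {p : Plain σ} {A : Fm HA𝓘 (σ ∷ Γ)} →
           H ⟪ proj₂ ⟫ ∧ˢ 𝐈 p proj₁ ⊢ sem A ⟪ uncurry _∷_ ⟫ →
           H ⊢ sem (∀′ p (rel (𝓘 p) (x₀ ∷ []) ⇒′ A))
∀𝓘-intro D = ∀-intro (⇒-intro D) ⨾ ⟨ same ⟩

∀𝓘-elim : {p : Plain σ} {A : Fm HA𝓘 (σ ∷ Γ)} {u : X → Env Γ} {h : X → ∣ σ ∣} →
          H ⊢ sem (∀′ p (rel (𝓘 p) (x₀ ∷ []) ⇒′ A)) ⟪ u ⟫ → H ⊢ 𝐈 p h →
          H ⊢ sem A ⟪ (λ x → h x ∷ u x) ⟫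
∀𝓘-elim {p = p} {A} {u} {h} D E = ⇒-elim
  (∀-elim {Q = 𝐈 p proj₁ ⇒ˢ sem A ⟪ (λ (y , x) → y ∷ u x) ⟫} h (D ⨾ ⟨ same ⟩) ⨾ ⟨ same ⟩) E

lift-≡ : (ρ : Tms (HACon Plain) Δ Γ) (yη : ∣ σ ∣ × Env Δ) →
         ᴴ.eval* (lift (σ ∷ []) ρ) (uncurry _∷_ yη) ≡ proj₁ yη ∷ ᴴ.eval* ρ (proj₂ yη)
lift-≡ {σ = σ} ρ (y , η) = ᴴ.eval*-lift (σ ∷ []) ρ (y ∷ []) η

mutual
  -- Substitution preserves the witness types of a formula, but not definitionally. Entailments in
  -- both directions avoid transport along equations of types, and implication, being contravariant,
  -- makes each direction depend on the other.
  sem-⟦⟧⁺ : (A : Fm HA Γ) (ρ : Tms (HACon Plain) Δ Γ) →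
            sem ((A ⟦ ρ ⟧) ^𝓘) ⊢ sem (A ^𝓘) ⟪ ᴴ.eval* ρ ⟫
  sem-⟦⟧⁺ ⊥′       ρ = ⟨ same ⟩
  sem-⟦⟧⁺ (A ∧′ B) ρ = ⟨ same ⟩ ⨾ ∧-mono (sem-⟦⟧⁺ A ρ) (sem-⟦⟧⁺ B ρ) ⨾ ⟨ same ⟩
  sem-⟦⟧⁺ (A ⇒′ B) ρ = ⟨ same ⟩ ⨾ ⇒-mono (sem-⟦⟧⁻ A ρ) (sem-⟦⟧⁺ B ρ) ⨾ ⟨ same ⟩
  sem-⟦⟧⁺ (∀′ p A) ρ = ⟨ same ⟩ ⨾
    ∀-mono (⇒-mono (⊢-refl (𝐈 p proj₁)) (sem-lift⁺ A ρ)) ⨾ ⟨ same ⟩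
  sem-⟦⟧⁺ (∃′ p A) ρ = ⟨ same ⟩ ⨾
    ∃-mono (∧-mono (⊢-refl (𝐈 p proj₁)) (sem-lift⁺ A ρ)) ⨾ ⟨ same ⟩
  sem-⟦⟧⁺ (_≈′_ {σ} s t) ρ =
    ⟨ weaken (λ η _ _ → subst₂ (Setoid._≈_ ⟦ σ ⟧ᵀ) (ᴴ.eval-[] s ρ η) (ᴴ.eval-[] t ρ η)) ⟩

  sem-⟦⟧⁻ : (A : Fm HA Γ) (ρ : Tms (HACon Plain) Δ Γ) →
            sem (A ^𝓘) ⟪ ᴴ.eval* ρ ⟫ ⊢ sem ((A ⟦ ρ ⟧) ^𝓘)
  sem-⟦⟧⁻ ⊥′       ρ = ⟨ same ⟩
  sem-⟦⟧⁻ (A ∧′ B) ρ = ⟨ same ⟩ ⨾ ∧-mono (sem-⟦⟧⁻ A ρ) (sem-⟦⟧⁻ B ρ) ⨾ ⟨ same ⟩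
  sem-⟦⟧⁻ (A ⇒′ B) ρ = ⟨ same ⟩ ⨾ ⇒-mono (sem-⟦⟧⁺ A ρ) (sem-⟦⟧⁻ B ρ) ⨾ ⟨ same ⟩
  sem-⟦⟧⁻ (∀′ p A) ρ = ⟨ same ⟩ ⨾
    ∀-mono (⇒-mono (⊢-refl (𝐈 p proj₁)) (sem-lift⁻ A ρ)) ⨾ ⟨ same ⟩
  sem-⟦⟧⁻ (∃′ p A) ρ = ⟨ same ⟩ ⨾
    ∃-mono (∧-mono (⊢-refl (𝐈 p proj₁)) (sem-lift⁻ A ρ)) ⨾ ⟨ same ⟩
  sem-⟦⟧⁻ (_≈′_ {σ} s t) ρ =
    ⟨ weaken (λ η _ _ → subst₂ (Setoid._≈_ ⟦ σ ⟧ᵀ) (sym (ᴴ.eval-[] s ρ η)) (sym (ᴴ.eval-[] t ρ η))) ⟩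

  sem-lift⁺ : (A : Fm HA (σ ∷ Γ)) (ρ : Tms (HACon Plain) Δ Γ) →
              sem ((A ⟦ lift (σ ∷ []) ρ ⟧) ^𝓘) ⟪ uncurry _∷_ ⟫ ⊢
              sem (A ^𝓘) ⟪ (λ (y , η) → y ∷ ᴴ.eval* ρ η) ⟫
  sem-lift⁺ A ρ = reindex _ (sem-⟦⟧⁺ A (lift _ ρ)) ⨾ ⟨ same ⟩ ⨾ ⟪⟫-≡ (lift-≡ ρ)

  sem-lift⁻ : (A : Fm HA (σ ∷ Γ)) (ρ : Tms (HACon Plain) Δ Γ) →
              sem (A ^𝓘) ⟪ (λ (y , η) → y ∷ ᴴ.eval* ρ η) ⟫ ⊢
              sem ((A ⟦ lift (σ ∷ []) ρ ⟧) ^𝓘) ⟪ uncurry _∷_ ⟫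
  sem-lift⁻ A ρ = ⟪⟫-≡ (λ yη → sym (lift-≡ ρ yη)) ⨾ ⟨ same ⟩ ⨾ reindex _ (sem-⟦⟧⁻ A (lift _ ρ))

-- Equal functions agree at each argument, so at a function type only the conclusion of the
-- implication changes and the witnesses remain valid.
⟦𝓘⟧-cong : (p : Plain σ) {x y : ∣ σ ∣} → Setoid._≈_ ⟦ σ ⟧ᵀ x y → ∀ {a b} → ⟦𝓘⟧ p x a b → ⟦𝓘⟧ p y a b
⟦𝓘⟧-cong nat     e {_ ∷ []} {[]} r = trans (sym e) r
⟦𝓘⟧-cong bool    e {_ ∷ []} {[]} r = trans (sym e) r
⟦𝓘⟧-cong (p ⇒ q) e r x h = ⟦𝓘⟧-cong q (e x) (r x h)

_≋_ : Env Γ → Env Γ → Set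
_≋_ {Γ} = Setoid._≈_ (Tuple Γ)

≋-sym : {η ζ : Env Γ} → η ≋ ζ → ζ ≋ η
≋-sym {Γ} {η} {ζ} = Setoid.sym (Tuple Γ) {η} {ζ}

≋-∷ : (x : ∣ σ ∣) {η ζ : Env Γ} → η ≋ ζ → (x ∷ η) ≋ (x ∷ ζ)
≋-∷ {σ} {Γ} x {η} {ζ} = ∷-cong {σ} {Γ} {x} {x} {η} {ζ} (Setoid.refl ⟦ σ ⟧ᵀ)

eval-cong : (t : Tm TargetCon Γ σ) {η ζ : Env Γ} → η ≋ ζ → Setoid._≈_ ⟦ σ ⟧ᵀ (eval t η) (eval t ζ)
eval-cong (var i)         e = e i
eval-cong {σ = σ} (con c) e = Setoid.refl ⟦ σ ⟧ᵀ
eval-cong {σ = σ} (s · t) {η} {ζ} e =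
  Setoid.trans ⟦ σ ⟧ᵀ (eval-cong s {η} {ζ} e (eval t η)) (Func.cong (eval s ζ) (eval-cong t {η} {ζ} e))

-- The substitution axiom for equality rests on this: the equality of the model is a setoid
-- equality, which `subst` cannot use at function types.
⟦⟧ᶠ-cong : (A : Fm HA𝓘 Γ) {η ζ : Env Γ} → η ≋ ζ → ∀ {a b} → ⟦ A ⟧ᶠ η a b → ⟦ A ⟧ᶠ ζ a b
⟦⟧ᶠ-cong (A ∧′ B) {η} {ζ} e (r , s) = ⟦⟧ᶠ-cong A {η} {ζ} e r , ⟦⟧ᶠ-cong B {η} {ζ} e s
⟦⟧ᶠ-cong (A ⇒′ B) {η} {ζ} e r h =
  ⟦⟧ᶠ-cong B {η} {ζ} e (r λ p → ⟦⟧ᶠ-cong A {ζ} {η} (≋-sym {η = η} {ζ} e) (h p))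
⟦⟧ᶠ-cong (∀′ _ A) {η} {ζ} e r x = ⟦⟧ᶠ-cong A {x ∷ η} {x ∷ ζ} (≋-∷ x {η} {ζ} e) (r x)
⟦⟧ᶠ-cong (∃′ _ A) {η} {ζ} e (x , r) = x , λ p → ⟦⟧ᶠ-cong A {x ∷ η} {x ∷ ζ} (≋-∷ x {η} {ζ} e) (r p)
⟦⟧ᶠ-cong (_≈′_ {σ} s t) {η} {ζ} e r = Setoid.trans ⟦ σ ⟧ᵀ
  (eval-cong (toTarget s) {ζ} {η} (≋-sym {η = η} {ζ} e))
  (Setoid.trans ⟦ σ ⟧ᵀ r (eval-cong (toTarget t) {η} {ζ} e))
⟦⟧ᶠ-cong (rel (𝓘 p) (t ∷ [])) {η} {ζ} e = ⟦𝓘⟧-cong p (eval-cong (toTarget t) {η} {ζ} e)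

true-equation : {s t : Tm (HACon Plain) Γ σ} →
                (∀ η → Setoid._≈_ ⟦ σ ⟧ᵀ (eval (toTarget s) η) (eval (toTarget t) η)) →
                ⊤ˢ ⊢ sem (s ≈′ t)
true-equation e = ⟨ weaken (λ η _ _ _ → e η) ⟩

sem-instance : (A : Fm HA (σ ∷ Γ)) {ρ : Tms (HACon Plain) Δ (σ ∷ Γ)} {u : X → Env Δ} {v : X → Env (σ ∷ Γ)} →
               (∀ x → ᴴ.eval* ρ (u x) ≡ v x) → sem ((A ⟦ ρ ⟧) ^𝓘) ⟪ u ⟫ ⊢ sem (A ^𝓘) ⟪ v ⟫
sem-instance A {ρ} {u} e = reindex u (sem-⟦⟧⁺ A ρ) ⨾ ⟨ same ⟩ ⨾ ⟪⟫-≡ e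

sem-instance⁻ : (A : Fm HA (σ ∷ Γ)) {ρ : Tms (HACon Plain) Δ (σ ∷ Γ)} {v : Env Δ → Env (σ ∷ Γ)} →
                (∀ η → ᴴ.eval* ρ η ≡ v η) → sem (A ^𝓘) ⟪ v ⟫ ⊢ sem ((A ⟦ ρ ⟧) ^𝓘)
sem-instance⁻ A {ρ} e = ⟪⟫-≡ (λ η → sym (e η)) ⨾ sem-⟦⟧⁻ A ρ

eval-recᴴ : (ps : All Plain σs) (i : σ ∈ σs) (n : Tm (HACon Plain) Γ nat)
            (w : Tms (HACon Plain) Γ σs) (f : Tms (HACon Plain) Γ (Steps σs)) (η : Env Γ) →
            eval (toTarget (con (recᶜ ps i) · n ·* w ·* f)) η ≡
            All.lookup (Recursor.rec σs (eval (toTarget n) η) (ᴴ.eval* w η) (ᴴ.eval* f η)) i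
eval-recᴴ {σs} {σ} ps i n w f η = trans (ᴴ.eval-·* (con (recᶜ ps i) · n ·* w) f η)
  (trans (cong (λ g → apply (Steps σs) σ g (ᴴ.eval* f η)) (ᴴ.eval-·* (con (recᶜ ps i) · n) w η))
    (eval-rec i (eval (toTarget n) η) (ᴴ.eval* w η) (ᴴ.eval* f η)))

eval-rec-suc : (ps : All Plain σs) (i : σ ∈ σs) (n : Tm (HACon Plain) Γ nat)
               (w : Tms (HACon Plain) Γ σs) (f : Tms (HACon Plain) Γ (Steps σs)) (η : Env Γ) →
               eval (toTarget (con (recᶜ ps i) · (con sucᶜ · n) ·* w ·* f)) η ≡
               eval (toTarget (All.lookup f (∈-map⁺ (Step σs) i) · n
                 ·* All.tabulate (λ j → con (recᶜ ps j) · n ·* w ·* f))) η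
eval-rec-suc {σs} {σ} ps i n w f η = begin
  eval (toTarget (con (recᶜ ps i) · (con sucᶜ · n) ·* w ·* f)) η
    ≡⟨ eval-recᴴ ps i (con sucᶜ · n) w f η ⟩
  All.lookup (Recursor.rec σs (suc m) W F) i
    ≡⟨ lookup-tabulate _ i ⟩
  apply σs σ (All.lookup F (∈-map⁺ (Step σs) i) ⟨$⟩ m) (Recursor.rec σs m W F)
    ≡⟨ cong₂ (λ g xs → apply σs σ (g ⟨$⟩ m) xs) g≡ R≡ ⟩
  apply σs σ (eval (toTarget g) η ⟨$⟩ m) (ᴴ.eval* R η)
    ≡⟨ ᴴ.eval-·* (g · n) R η ⟨
  eval (toTarget (g · n ·* R)) η ∎
  where
  open ≡-Reasoning
  m = eval (toTarget n) η
  W = ᴴ.eval* w η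
  F = ᴴ.eval* f η
  g = All.lookup f (∈-map⁺ (Step σs) i)
  g≡ : All.lookup F (∈-map⁺ (Step σs) i) ≡ eval (toTarget g) η
  g≡ = lookup-map f (∈-map⁺ (Step σs) i)
  R : Tms (HACon Plain) _ σs
  R = All.tabulate (λ j → con (recᶜ ps j) · n ·* w ·* f)
  R≡ : Recursor.rec σs m W F ≡ ᴴ.eval* R η
  R≡ = sym (trans (map-tabulate _ _)
    (trans (tabulate-cong (λ j → eval-recᴴ ps j n w f η)) (tabulate-lookup (Recursor.rec σs m W F))))

axiom-realized : {A : Fm HA Γ} → Axiom A → ⊤ˢ ⊢ sem (A ^𝓘)
axiom-realized (≈-refl {σ} _) = true-equation λ η → Setoid.refl ⟦ σ ⟧ᵀ
axiom-realized (≈-subst {Γ} {σ} p A) = sem-⇒-intro (sem-⇒-intro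
  -- Both instances of `A` are read as the one problem `sem (A ^𝓘)`, at the environments `x ∷ ζ` and
  -- `y ∷ ζ`. The equation carries no witnesses, so a realizer passes from one to the other
  -- unchanged.
  (∧-mono snd (⟨ same ⟩ ⨾ sem-instance A {u = id} {u₁} λ { η@(y ∷ x ∷ ζ) → cong (x ∷_) (wk-≡ η) })
  ⨾ ⟨ weaken (λ { (y ∷ x ∷ ζ) a b (e , r) → ⟦⟧ᶠ-cong (A ^𝓘) {x ∷ ζ} {y ∷ ζ}
        (λ { (here refl) → e ; (there i) → Setoid.refl (Tuple Γ) {ζ} i }) r }) ⟩
  ⨾ sem-instance⁻ A {v = u₀} λ { η@(y ∷ x ∷ ζ) → cong (y ∷_) (wk-≡ η) }))
  where
  u₀ u₁ : Env (σ ∷ σ ∷ Γ) → Env (σ ∷ Γ)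
  u₀ (y ∷ x ∷ ζ) = y ∷ ζ
  u₁ (y ∷ x ∷ ζ) = x ∷ ζ
  wk-≡ : ∀ (η : Env (σ ∷ σ ∷ Γ)) → ᴴ.eval* (wk (σ ∷ σ ∷ [])) η ≡ ++⁻ʳ (σ ∷ σ ∷ []) η
  wk-≡ (y ∷ x ∷ ζ) = ᴴ.eval*-wk (σ ∷ σ ∷ []) (y ∷ x ∷ []) ζ
axiom-realized (Π-eq {σ} _ _) = true-equation λ { (_ ∷ _ ∷ []) → Setoid.refl ⟦ σ ⟧ᵀ }
axiom-realized (Σ-eq {τ = τ} _ _ _) = true-equation λ { (_ ∷ _ ∷ _ ∷ []) → Setoid.refl ⟦ τ ⟧ᵀ }
axiom-realized suc-inj = sem-⇒-intro ⟨ weaken (λ { (_ ∷ _ ∷ []) _ _ (_ , refl) → refl }) ⟩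
axiom-realized suc≉0 = sem-⇒-intro ⟨ weaken (λ { (_ ∷ []) _ _ (_ , ()) }) ⟩
axiom-realized (rec-0 {σs} {σ} ps i) = true-equation λ η → Setoid.reflexive ⟦ σ ⟧ᵀ
  (trans (eval-recᴴ ps i (con zeroᶜ) (locals σs) (wk σs) η) (lookup-map (locals σs) i))
axiom-realized (rec-suc {σs} {σ} ps i) = true-equation λ η → Setoid.reflexive ⟦ σ ⟧ᵀ
  (eval-rec-suc ps i x₀ (locals σs [ wk (nat ∷ []) ]*) (wk (nat ∷ σs)) η)
axiom-realized 0≉1 = sem-⇒-intro ⟨ weaken (λ { _ _ _ (_ , ()) }) ⟩
axiom-realized (bool-ind D) = sem-⇒-intro (∀𝓘-intro (𝔹-cases
  (snd ⨾ sem-fst ⨾ ⟨ same ⟩ ⨾ sem-instance D {u = id} (λ η → cong (false ∷_) (ᴴ.eval*-vars η)) ⨾ ⟨ same ⟩)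
  (snd ⨾ sem-snd ⨾ ⟨ same ⟩ ⨾ sem-instance D {u = id} (λ η → cong (true ∷_) (ᴴ.eval*-vars η)) ⨾ ⟨ same ⟩)))
axiom-realized (cond-0 {σ} _) = true-equation λ { (_ ∷ _ ∷ []) → Setoid.refl ⟦ σ ⟧ᵀ }
axiom-realized (cond-1 {σ} _) = true-equation λ { (_ ∷ _ ∷ []) → Setoid.refl ⟦ σ ⟧ᵀ }
-- The relativized induction step asks for 𝓘_ℕ at n, which `ℕ-induction` supplies as an assumption
-- of its own step.
axiom-realized (nat-ind A) = sem-⇒-intro (∀𝓘-intro (ℕ-induction
  (snd ⨾ sem-fst ⨾ ⟨ same ⟩ ⨾ sem-instance A {u = id} (λ η → cong (zero ∷_) (ᴴ.eval*-vars η)) ⨾ ⟨ same ⟩)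
  (sem-⇒-elim
    (∀𝓘-elim (fst ⨾ fst ⨾ reindex proj₂ (snd ⨾ sem-snd)) (fst ⨾ snd) ⨾ ⟨ same ⟩) snd
   ⨾ sem-instance A {u = uncurry _∷_} {λ (n , η) → suc n ∷ η}
       (λ (n , η) → cong (suc n ∷_) (ᴴ.eval*-wk (nat ∷ []) (n ∷ []) η)) ⨾ ⟨ same ⟩)))

-- Universal closure, application and the conclusion

𝓘-⇒-intro : (ps : All Plain σs) (ts : Tms (HACon Plain) Γ σs) {A : Fm HA𝓘 Γ} →
            ⊤ˢ ⊢ sem A → ⊤ˢ ⊢ sem (𝓘[ ps ] ts ⇒ A)
𝓘-⇒-intro []       []       D = D
𝓘-⇒-intro (p ∷ ps) (t ∷ ts) D = sem-⇒-intro (fst ⨾ 𝓘-⇒-intro ps ts D)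

∀-generalize : {p : Plain σ} {A : Fm HA𝓘 (σ ∷ Γ)} → ⊤ˢ ⊢ sem A → ⊤ˢ ⊢ sem (∀′ p A)
∀-generalize D = ∀-intro (⟨ same ⟩ ⨾ reindex (uncurry _∷_) D) ⨾ ⟨ same ⟩

close-intro : (ps : All Plain Γ) {A : Fm HA𝓘 Γ} → ⊤ˢ ⊢ sem A → ⊤ˢ ⊢ sem (close ps A)
close-intro []       D = D
close-intro (p ∷ ps) D = close-intro ps (∀-generalize D)

application-realized : (p : Plain σ) (q : Plain τ) →
  ⊤ˢ ⊢ sem {σ ⇒ τ ∷ σ ∷ []}
    (rel (𝓘 p) (x₁ ∷ []) ∧′ rel (𝓘 (p ⇒ q)) (x₀ ∷ []) ⇒′ rel (𝓘 q) (x₀ · x₁ ∷ []))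
application-realized p q = sem-⇒-intro
  (𝐈-elim {p = p} {q} {h = eval x₀} {k = eval x₁}
    (snd ⨾ sem-snd ⨾ ⟨ same ⟩) (snd ⨾ sem-fst ⨾ ⟨ same ⟩) ⨾ ⟨ same ⟩)

theorem7p5 : SoundTypeInformative 𝓘ᶜᵖ
theorem7p5 = record
  { constants   = λ p c → interpretable (rel (𝓘 p) (con c ∷ [])) (constant-realized c p ⨾ ⟨ same ⟩)
  ; application = λ p q → interpretable (∀′ p (∀′ (p ⇒ q) _))
      (∀-generalize (∀-generalize (application-realized p q)))
  ; axioms      = λ ps {A} a → interpretable (close ps (𝓘[ ps ] vars ⇒ (A ^𝓘)))
      (close-intro ps (𝓘-⇒-intro ps vars (axiom-realized a)))
  }
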